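{- For any (fixed) integer $\ell\geq 0$, determining whether a given $(1,\ell)$-graph $G$ is well-covered can be done in polynomial time even when no $(1,\ell)$-partition of $G$ is provided.
   Context: Graphs are finite, simple and undirected. For integers $k,\ell\ge 0$, a $(k,\ell)$-graph is a graph whose vertex set can be partitioned into $k$ independent sets and $\ell$ cliques, where parts are allowed to be empty (and a single vertex may be counted either as an independent set or as a clique); such a partition is a $(k,\ell)$-partition. A graph is well-covered if all its maximal (with respect to inclusion) independent sets have the same cardinality. -}

module Defs where

open import Data.Bool using (Bool; false; T; if_then_else_)
open import Data.Fin using (Fin; remQuot)
open import Data.Fin.Subset using (Subset; _∈_; _⊆_; ∣_∣)
open import Data.List using (List; _∷_; length; tabulate; head; drop)
open import Data.Maybe using (fromMaybe)
open import Data.Nat using (ℕ; zero; suc; _+_; _*_; _∸_; _^_; _≤_; _≡ᵇ_)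
open import Data.Product using (_×_; ∃-syntax; uncurry)
open import Data.Sum using (_⊎_; inj₁; inj₂)
open import Relation.Nullary using (¬_)
open import Relation.Binary.PropositionalEquality using (_≡_; _≢_)

record Graph (n : ℕ) : Set where
  field
    adj    : Fin n → Fin n → Bool
    sym    : ∀ u v → adj u v ≡ adj v u
    irrefl : ∀ u → adj u u ≡ false

  Adjacent : Fin n → Fin n → Set
  Adjacent u v = T (adj u v)

open Graph public using (adj; Adjacent)

-- `class` need not be surjective: parts may be empty.

record Partition (k ℓ : ℕ) {n : ℕ} (G : Graph n) : Set where
  field
    class       : Fin n → Fin k ⊎ Fin ℓ
    independent : ∀ i {u v} → class u ≡ inj₁ i → class v ≡ inj₁ i →
                  ¬ Adjacent G u v
    clique      : ∀ j {u v} → class u ≡ inj₂ j → class v ≡ inj₂ j →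
                  u ≢ v → Adjacent G u v

Independent : ∀ {n} → Graph n → Subset n → Set
Independent G I = ∀ {u v} → u ∈ I → v ∈ I → ¬ Adjacent G u v

MaximalIndependent : ∀ {n} → Graph n → Subset n → Set
MaximalIndependent G I =
  Independent G I × (∀ J → Independent G J → I ⊆ J → J ⊆ I)

WellCovered : ∀ {n} → Graph n → Set
WellCovered G =
  ∀ I J → MaximalIndependent G I → MaximalIndependent G J → ∣ I ∣ ≡ ∣ J ∣

-- Random access machines (Cook and Reckhow, "Time bounded random access
-- machines", 1973), over ℕ with truncated subtraction.  As in
-- Papadimitriou's "Computational Complexity", the input is a read-only
-- array with random access.
--
-- Every instruction costs one step.  There is no multiplication, so t
-- steps create only numbers of O(t + s) bits, where s bounds the number
-- of bits of each input entry; hence polynomial time here is polynomial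
-- time on Turing machines.

data Instr : Set where
  const : (d c : ℕ)   → Instr
  add   : (d r s : ℕ) → Instr
  sub   : (d r s : ℕ) → Instr
  load  : (d r : ℕ)   → Instr
  store : (d r : ℕ)   → Instr
  read  : (d r : ℕ)   → Instr
  jump  : (r a : ℕ)   → Instr
  halt  : Instr

Program : Set
Program = List Instr

Word : Set
Word = List ℕ

-- Indices start at 0; reading beyond the end yields 0.
inputAt : Word → ℕ → ℕ
inputAt w i = fromMaybe 0 (head (drop i w))

-- Running off the end of the program halts.
fetch : Program → ℕ → Instr
fetch p i = fromMaybe halt (head (drop i p))

Registers : Set
Registers = ℕ → ℕ

_[_↦_] : Registers → ℕ → ℕ → Registers
(X [ d ↦ x ]) r = if r ≡ᵇ d then x else X r

record Config : Set where
  constructor ⟨_,_⟩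
  field
    pc  : ℕ
    reg : Registers

open Config public

exec : Word → Instr → Config → Config
exec w (const d c) ⟨ i , X ⟩ = ⟨ suc i , X [ d ↦ c ] ⟩
exec w (add d r s) ⟨ i , X ⟩ = ⟨ suc i , X [ d ↦ X r + X s ] ⟩
exec w (sub d r s) ⟨ i , X ⟩ = ⟨ suc i , X [ d ↦ X r ∸ X s ] ⟩
exec w (load d r)  ⟨ i , X ⟩ = ⟨ suc i , X [ d ↦ X (X r) ] ⟩
exec w (store d r) ⟨ i , X ⟩ = ⟨ suc i , X [ X d ↦ X r ] ⟩
exec w (read d r)  ⟨ i , X ⟩ = ⟨ suc i , X [ d ↦ inputAt w (X r) ] ⟩
exec w (jump r a)  ⟨ i , X ⟩ = ⟨ (if X r ≡ᵇ 0 then suc i else a) , X ⟩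
exec w halt        C         = C

step : Program → Word → Config → Config
step p w C = exec w (fetch p (pc C)) C

run : Program → Word → ℕ → Config → Config
run p w zero    C = C
run p w (suc t) C = run p w t (step p w C)

initial : Config
initial = ⟨ 0 , (λ _ → 0) ⟩

HaltsWith : Program → Word → ℕ → ℕ → Set
HaltsWith p w t x = fetch p (pc C) ≡ halt × reg C 0 ≡ x
  where C = run p w t initial

-- The number of vertices, then the adjacency matrix row by row:
-- entry 1 + (u * n + v) is 1 if u and v are adjacent and 0 otherwise.
encode : ∀ {n} → Graph n → Word
encode {n} G = n ∷ tabulate {n = n * n} (λ i → uncurry entry (remQuot n i))
  where
  entry : Fin n → Fin n → ℕ
  entry u v = if adj G u v then 1 else 0

GraphProperty : Set₁
GraphProperty = ∀ {n} → Graph n → Set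

-- One program answers 1 or 0 correctly, within time polynomial in the
-- length of the input, on every graph satisfying Promise.  Its only input
-- is the graph; nothing is required of it on other graphs.
PolyTimeDecidable : (Promise P : GraphProperty) → Set
PolyTimeDecidable Promise P =
  ∃[ p ] ∃[ c ] ∃[ d ] ∀ {n} (G : Graph n) → Promise G →
    ∃[ t ] t ≤ c * length (encode G) ^ d + c ×
           (HaltsWith p (encode G) t 1 × P G ⊎
            HaltsWith p (encode G) t 0 × ¬ P G)

{-# OPTIONS --safe #-}

-- Let S be the independent part of a (1,ℓ)-partition, unknown to the
-- algorithm, and let T be any maximal independent set, found greedily.  An
-- independent set has at most ℓ vertices outside S.  Suppose that, for every
-- tuple q of 2ℓ + 1 vertices, the greedy algorithm trying the vertices in the
-- order q, T, all, yields a set of size |T|.  If J is independent and q lists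
-- vertices of J, that set contains q and T ∩ J.  With q listing ℓ + 1 vertices
-- of S ─ T it would be larger than T; hence |S ─ T| ≤ ℓ.  So every maximal
-- independent set I satisfies |I ─ T| ≤ |I ─ S| + |S ─ T| ≤ 2ℓ, and with q
-- listing I ─ T the greedy set is I itself, whence |I| = |T|.
-- Since the greedy sets are always maximal independent sets, G is well-covered
-- if and only if all of them have size |T|.

module Submission where

open import Algebra.Properties.CommutativeSemigroup using (x∙yz≈y∙xz)
open import Data.Bool as Bool using (Bool; true; false; T; _∧_; not; if_then_else_)
open import Data.Bool.Properties using (T-≡)
open import Data.Empty using (⊥)
open import Data.Fin using (Fin; zero; suc; toℕ; fromℕ<; combine; remQuot)
import Data.Fin as Fin
import Data.Fin.Properties as Fin
open import Data.Fin.Properties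
  using (toℕ<n; toℕ-fromℕ<; toℕ-injective; toℕ-combine; remQuot-combine; injective⇒≤)
open import Data.Fin.Subset
  using (Subset; inside; outside; _∈_; _∉_; _⊆_; ∣_∣; _∩_; _─_)
open import Data.Fin.Subset.Properties
  using (_∈?_; ∣p∣≤n; p─q⊆p; x∈p∧x∉q⇒x∈p─q; p⊆q⇒∣p∣≤∣q∣; p∩q⊆p; p∩q⊆q; x∈p∩q⁺; ⊆-antisym)
import Data.List as List
open import Data.List using ([]; _∷_; _++_; length)
open import Data.List.Properties using (length-++; length-tabulate)
open import Data.Nat
  using (ℕ; zero; suc; pred; _+_; _*_; _∸_; _^_; _⊓_; _≤_; _<_; _≡ᵇ_; _<ᵇ_; _≤ᵇ_; _≟_; _<?_;
         z≤n; s≤s; s≤s⁻¹; NonZero; >-nonZero; >-nonZero⁻¹)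
open import Data.Nat.Properties
open import Data.Product as Product using (_×_; _,_; ∃-syntax; proj₁; proj₂; uncurry)
open import Data.Sum as Sum using (_⊎_; inj₁; inj₂; [_,_]′; map₁)
open import Data.Unit using (⊤; tt)
open import Data.Vec using ([]; _∷_; tabulate; here; there)
open import Data.Vec.Properties using (lookup∘tabulate; lookup⇒[]=; []=⇒lookup; tabulate-cong)
open import Function using (_∘_; id; Equivalence)
open import Relation.Binary.Definitions using (tri<; tri≈; tri>)
open import Relation.Nullary using (¬_; yes; no; does; contradiction)
open import Relation.Nullary.Decidable using (dec-true; dec-false)
open import Relation.Binary.PropositionalEquality
open import Defs

-- The obstacle is that `S` is unknown and `T` is arbitrary, so at first nothing bounds `S ─ T`. One
-- family of tests therefore does two jobs: passing it first forces |S ─ T| ≤ ℓ, and only then is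
-- every `I ─ T` known to be short enough to be listed by a tuple. The two uses need ℓ + 1 and 2ℓ
-- vertices; 2ℓ + 1 covers both, also for ℓ = 0.
--
-- Tuples need not be independent: the greedy run passes over a vertex that is already blocked. A
-- difference in size thus refutes well-coveredness in every graph, and the partition is needed only
-- to show that equal sizes suffice. Since ℓ is fixed, the n^(2ℓ + 1) tuples are polynomially many.

private variable
  m n : ℕ

-- Cardinalities of finite sets

x∈p─q⇒x∉q : ∀ (p q : Subset n) {x} → x ∈ p ─ q → x ∉ q
x∈p─q⇒x∉q (_ ∷ p) (inside  ∷ q) (there x∈p─q) (there x∈q) = x∈p─q⇒x∉q p q x∈p─q x∈q
x∈p─q⇒x∉q (_ ∷ p) (outside ∷ q) (there x∈p─q) (there x∈q) = x∈p─q⇒x∉q p q x∈p─q x∈q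

∣p∣≡∣p∩q∣+∣p─q∣ : ∀ (p q : Subset n) → ∣ p ∣ ≡ ∣ p ∩ q ∣ + ∣ p ─ q ∣
∣p∣≡∣p∩q∣+∣p─q∣ []            []            = refl
∣p∣≡∣p∩q∣+∣p─q∣ (inside  ∷ p) (inside  ∷ q) = cong suc (∣p∣≡∣p∩q∣+∣p─q∣ p q)
∣p∣≡∣p∩q∣+∣p─q∣ (inside  ∷ p) (outside ∷ q) =
  trans (cong suc (∣p∣≡∣p∩q∣+∣p─q∣ p q)) (sym (+-suc ∣ p ∩ q ∣ _))
∣p∣≡∣p∩q∣+∣p─q∣ (outside ∷ p) (inside  ∷ q) = ∣p∣≡∣p∩q∣+∣p─q∣ p q
∣p∣≡∣p∩q∣+∣p─q∣ (outside ∷ p) (outside ∷ q) = ∣p∣≡∣p∩q∣+∣p─q∣ p q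

-- A triangle inequality: an element of `p ─ r` lies in `q ─ r` or in `p ─ q`, according to whether
-- it is in `q`. It compares `I` with `T` by way of the unknown `S`.
∣p─r∣≤∣p─q∣+∣q─r∣ : ∀ (p q r : Subset n) → ∣ p ─ r ∣ ≤ ∣ p ─ q ∣ + ∣ q ─ r ∣
∣p─r∣≤∣p─q∣+∣q─r∣ p q r = begin
  ∣ p ─ r ∣                            ≡⟨ ∣p∣≡∣p∩q∣+∣p─q∣ (p ─ r) q ⟩
  ∣ (p ─ r) ∩ q ∣ + ∣ p ─ r ─ q ∣      ≤⟨ +-mono-≤ (p⊆q⇒∣p∣≤∣q∣ left) (p⊆q⇒∣p∣≤∣q∣ right) ⟩
  ∣ q ─ r ∣ + ∣ p ─ q ∣                ≡⟨ +-comm ∣ q ─ r ∣ _ ⟩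
  ∣ p ─ q ∣ + ∣ q ─ r ∣                ∎
  where
  open ≤-Reasoning
  left : (p ─ r) ∩ q ⊆ q ─ r
  left x∈ = x∈p∧x∉q⇒x∈p─q (p∩q⊆q (p ─ r) q x∈)
                          (x∈p─q⇒x∉q p r (p∩q⊆p (p ─ r) q x∈))
  right : p ─ r ─ q ⊆ p ─ q
  right x∈ = x∈p∧x∉q⇒x∈p─q (p─q⊆p p r (p─q⊆p (p ─ r) q x∈)) (x∈p─q⇒x∉q (p ─ r) q x∈)

-- Cuts a set of unbounded size, such as `S ─ T`, down to what fits into a tuple.
prune : ℕ → Subset n → Subset n
prune k       []            = []
prune k       (outside ∷ p) = outside ∷ prune k p
prune zero    (inside  ∷ p) = outside ∷ prune zero p
prune (suc k) (inside  ∷ p) = inside ∷ prune k p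

prune-⊆ : ∀ k (p : Subset n) → prune k p ⊆ p
prune-⊆ k       (outside ∷ p) (there x∈) = there (prune-⊆ k p x∈)
prune-⊆ zero    (inside  ∷ p) (there x∈) = there (prune-⊆ zero p x∈)
prune-⊆ (suc k) (inside  ∷ p) here       = here
prune-⊆ (suc k) (inside  ∷ p) (there x∈) = there (prune-⊆ k p x∈)

∣prune∣ : ∀ k (p : Subset n) → ∣ prune k p ∣ ≡ k ⊓ ∣ p ∣
∣prune∣ k       []            = sym (⊓-zeroʳ k)
∣prune∣ k       (outside ∷ p) = ∣prune∣ k p
∣prune∣ zero    (inside  ∷ p) = ∣prune∣ zero p
∣prune∣ (suc k) (inside  ∷ p) = cong suc (∣prune∣ k p)

element : (p : Subset n) → Fin ∣ p ∣ → Fin n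
element (outside ∷ p) i       = suc (element p i)
element (inside  ∷ p) zero    = zero
element (inside  ∷ p) (suc i) = suc (element p i)

element-∈ : ∀ (p : Subset n) i → element p i ∈ p
element-∈ (outside ∷ p) i       = there (element-∈ p i)
element-∈ (inside  ∷ p) zero    = here
element-∈ (inside  ∷ p) (suc i) = there (element-∈ p i)

element-injective : ∀ (p : Subset n) {i j} → element p i ≡ element p j → i ≡ j
element-injective (outside ∷ p) eq = element-injective p (Fin.suc-injective eq)
element-injective (inside  ∷ p) {zero}  {zero}  eq = refl
element-injective (inside  ∷ p) {suc i} {suc j} eq =
  cong suc (element-injective p (Fin.suc-injective eq))

element-surjective : ∀ (p : Subset n) {x} → x ∈ p → ∃[ i ] element p i ≡ x
element-surjective (inside  ∷ p) here       = zero , refl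
element-surjective (inside  ∷ p) (there x∈) with element-surjective p x∈
... | i , eq = suc i , cong suc eq
element-surjective (outside ∷ p) (there x∈) with element-surjective p x∈
... | i , eq = i , cong suc eq

-- The map `c` receives the membership proof because the clique of a vertex exists only for vertices
-- outside `S`.
injection⇒∣p∣≤ : ∀ (p : Subset n) (c : ∀ {x} → x ∈ p → Fin m) →
                 (∀ {x y} (x∈ : x ∈ p) (y∈ : y ∈ p) → c x∈ ≡ c y∈ → x ≡ y) → ∣ p ∣ ≤ m
injection⇒∣p∣≤ p c inj = injective⇒≤ {f = λ i → c (element-∈ p i)}
  (λ eq → element-injective p (inj (element-∈ p _) (element-∈ p _) eq))

-- The sequence repeats its first entry once p is exhausted.
sequence : ∀ K (p : Subset n) → 0 < ∣ p ∣ → ∣ p ∣ ≤ K →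
           ∃[ q ] (∀ (i : ℕ) → q i ∈ p) × (∀ {x} → x ∈ p → ∃[ i ] i < K × q i ≡ x)
sequence {n} K p 0<∣p∣ ∣p∣≤K = q , q∈ , q-onto
  where
  index : ℕ → Fin ∣ p ∣
  index i with i <? ∣ p ∣
  ... | yes i< = fromℕ< i<
  ... | no  _  = fromℕ< 0<∣p∣
  q : ℕ → Fin n
  q i = element p (index i)
  q∈ : ∀ i → q i ∈ p
  q∈ i = element-∈ p (index i)
  index-toℕ : ∀ j → index (toℕ j) ≡ j
  index-toℕ j with toℕ j <? ∣ p ∣
  ... | yes j< = Fin.fromℕ<-toℕ j j<
  ... | no  j≮ = contradiction (toℕ<n j) j≮
  q-onto : ∀ {x} → x ∈ p → ∃[ i ] i < K × q i ≡ x
  q-onto x∈ with element-surjective p x∈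
  ... | j , eq = toℕ j , ≤-trans (toℕ<n j) ∣p∣≤K , trans (cong (element p) (index-toℕ j)) eq

bit : Bool → ℕ
bit b = if b then 1 else 0

-- The value of a machine counter after `k` rounds of a loop over the vertices.
prefixCount : (Fin n → Bool) → ℕ → ℕ
prefixCount {zero}  f k       = 0
prefixCount {suc n} f zero    = 0
prefixCount {suc n} f (suc k) = bit (f zero) + prefixCount (f ∘ suc) k

prefixCount-zero : ∀ (f : Fin n → Bool) → prefixCount f 0 ≡ 0
prefixCount-zero {zero}  f = refl
prefixCount-zero {suc n} f = refl

prefixCount-suc : ∀ (f : Fin n → Bool) i →
                  prefixCount f (suc (toℕ i)) ≡ prefixCount f (toℕ i) + bit (f i)
prefixCount-suc {suc n} f zero    =
  trans (cong (bit (f zero) +_) (prefixCount-zero (f ∘ suc))) (+-identityʳ (bit (f zero)))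
prefixCount-suc {suc n} f (suc i) =
  trans (cong (bit (f zero) +_) (prefixCount-suc (f ∘ suc) i)) (sym (+-assoc (bit (f zero)) _ _))

prefixCount-all : ∀ (f : Fin n → Bool) → prefixCount f n ≡ ∣ tabulate f ∣
prefixCount-all {zero}  f = refl
prefixCount-all {suc n} f with f zero
... | true  = cong suc (prefixCount-all (f ∘ suc))
... | false = prefixCount-all (f ∘ suc)

∈-tabulate⁺ : ∀ (f : Fin n → Bool) {v} → f v ≡ true → v ∈ tabulate f
∈-tabulate⁺ f {v} eq = lookup⇒[]= v (tabulate f) (trans (lookup∘tabulate f v) eq)

∈-tabulate⁻ : ∀ (f : Fin n → Bool) {v} → v ∈ tabulate f → f v ≡ true
∈-tabulate⁻ f {v} v∈ = trans (sym (lookup∘tabulate f v)) ([]=⇒lookup v∈)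

adjacent : ∀ {b} → b ≡ true → T b
adjacent = Equivalence.from T-≡

-- Greedy independent sets

-- Since `adj` is irreflexive, a free `v` stays free when it is tried; so `f` alone records the
-- chosen vertices as well.
try : Graph n → Fin n → (Fin n → Bool) → Fin n → Bool
try G v f u = if f v then f u ∧ not (adj G u v) else f u

-- A run of the greedy algorithm: D holds the vertices tried so far, and f the
-- vertices without a neighbour among the chosen ones.  A tried vertex is
-- chosen exactly when it is (and then forever remains) in f.
record Greedy (G : Graph n) (D : Fin n → Set) (f : Fin n → Bool) : Set where
  field
    blocks  : ∀ {u v} → D v → f v ≡ true → Adjacent G u v → f u ≡ false
    blocked : ∀ {u} → f u ≡ false → ∃[ v ] D v × f v ≡ true × Adjacent G u v

open Greedy

Keeps : (D : Fin n → Set) (f f′ : Fin n → Bool) → Set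
Keeps D f f′ = ∀ {v} → D v → f v ≡ true → f′ v ≡ true

module _ {n} (G : Graph n) where

  Adjacent-sym : ∀ {u v} → Adjacent G u v → Adjacent G v u
  Adjacent-sym {u} {v} = subst T (Graph.sym G u v)

  greedy-⇔ : ∀ {D D′ f} → (∀ {v} → D v → D′ v) → (∀ {v} → D′ v → D v) →
             Greedy G D f → Greedy G D′ f
  greedy-⇔ to from g .blocks D′v = g .blocks (from D′v)
  greedy-⇔ to from g .blocked fu with g .blocked fu
  ... | v , Dv , fv , uv = v , to Dv , fv , uv

  module _ {D : Fin n → Set} {f : Fin n → Bool} (g : Greedy G D f) (x : Fin n) where

    private
      D′ : Fin n → Set
      D′ v = D v ⊎ v ≡ x

    -- A chosen `v` cannot be adjacent to a free `x`, for `v` would already have blocked `x`.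
    try-keeps : Keeps D f (try G x f)
    try-keeps {v} Dv fv with f x in fx
    ... | false = fv
    ... | true  rewrite fv with adj G v x in vx
    ...   | false = refl
    ...   | true  with trans (sym fx) (g .blocks Dv fv (Adjacent-sym (adjacent vx)))
    ...     | ()

    -- If `x` is blocked, `f` does not change and `x` counts as tried but not chosen. If `x` is
    -- free, it is the only new source of blocking, and the earlier chosen vertices survive by
    -- `try-keeps`.
    try-greedy : Greedy G D′ (try G x f)
    try-greedy .blocks {u} {v} D′v fv uv with f x in fx
    try-greedy .blocks (inj₁ Dv)   fv uv | false = g .blocks Dv fv uv
    try-greedy .blocks (inj₂ refl) fv uv | false with trans (sym fx) fv
    ... | ()
    try-greedy .blocks {u} {v} D′v fv uv | true with f v in fv≡ | f u in fu≡ | D′v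
    ... | _    | false | _         = refl
    ... | true | true  | inj₁ Dv   with trans (sym (g .blocks Dv fv≡ uv)) fu≡
    ...   | ()
    try-greedy .blocks {u} {v} D′v fv uv | true | true | true | inj₂ refl
      rewrite Equivalence.to T-≡ uv = refl
    try-greedy .blocked {u} fu with f x in fx
    try-greedy .blocked {u} fu | false with g .blocked fu
    ... | v , Dv , fv , uv = v , inj₁ Dv , fv , uv
    try-greedy .blocked {u} fu | true with f u in fu≡
    try-greedy .blocked {u} fu | true | true with adj G u x in ux
    ... | true = x , inj₂ refl , eq , adjacent ux
      where
      eq : f x ∧ not (adj G x x) ≡ true
      eq rewrite fx | Graph.irrefl G x = refl
    try-greedy .blocked {u} fu | true | false with g .blocked fu≡
    ... | v , Dv , fv , uv = v , inj₁ Dv , kept , uv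
      where
      kept : f v ∧ not (adj G v x) ≡ true
      kept = trans (cong (λ b → if b then f v ∧ not (adj G v x) else f v) (sym fx)) (try-keeps Dv fv)

  -- Once all vertices are tried, free and chosen mean the same: `blocks` gives independence, and
  -- `blocked` gives every excluded vertex a chosen neighbour.
  greedy-maximal : ∀ {D f} → Greedy G D f → (∀ v → D v) → MaximalIndependent G (tabulate f)
  greedy-maximal {D} {f} g all = independent , maximal
    where
    independent : Independent G (tabulate f)
    independent u∈ v∈ uv
      with trans (sym (∈-tabulate⁻ f u∈)) (g .blocks (all _) (∈-tabulate⁻ f v∈) uv)
    ... | ()
    maximal : ∀ J → Independent G J → tabulate f ⊆ J → J ⊆ tabulate f
    maximal J indJ f⊆J {u} u∈J with f u in fu
    ... | true  = ∈-tabulate⁺ f fu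
    ... | false with g .blocked fu
    ...   | v , _ , fv , uv = contradiction uv (indJ u∈J (f⊆J (∈-tabulate⁺ f fv)))

  -- Tuples forced into greedy sets, and the criterion for well-coveredness

  Entry : ℕ → (ℕ → Fin n) → Fin n → Set
  Entry K q v = ∃[ i ] i < K × q i ≡ v

  -- What is used of a greedy run that tries q 0, …, q (K - 1), then T.
  Unrestrained : ℕ → (ℕ → Fin n) → Subset n → Subset n → Set
  Unrestrained K q T F = ∀ J → Independent G J → (∀ {i} → i < K → q i ∈ J) →
                         (∀ {i} → i < K → q i ∈ F) × T ∩ J ⊆ F

  -- The order of trial matters. During the first stage only entries of `q` can block, and they all
  -- lie in the independent set `J`. During the second, a vertex of `T ∩ J` could be blocked only by
  -- an entry of `q`, excluded by `J`, or by a vertex of `T`, excluded by the independence of `T`.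
  -- Later stages lose nothing that was chosen.
  greedy-unrestrained : ∀ {K q f₁ f₂ f₃} (t : Fin n → Bool) → Independent G (tabulate t) →
    let D₁ = Entry K q
        D₂ = λ v → D₁ v ⊎ t v ≡ true
    in Greedy G D₁ f₁ → Keeps D₁ f₁ f₂ → Greedy G D₂ f₂ → Keeps D₂ f₂ f₃ →
       Unrestrained K q (tabulate t) (tabulate f₃)
  greedy-unrestrained {K} {q} {f₁} {f₂} {f₃} t indT g₁ k₁ g₂ k₂ J indJ q∈J = q-free , t-free
    where
    q-free : ∀ {i} → i < K → q i ∈ tabulate f₃
    q-free {i} i<K with f₁ (q i) in eq
    ... | true  = ∈-tabulate⁺ f₃ (k₂ (inj₁ (i , i<K , refl)) (k₁ (i , i<K , refl) eq))
    ... | false with g₁ .blocked eq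
    ...   | _ , (j , j<K , refl) , _ , ij = contradiction ij (indJ (q∈J i<K) (q∈J j<K))
    t-free : tabulate t ∩ J ⊆ tabulate f₃
    t-free {v} v∈ with f₂ v in eq
    ... | true  = ∈-tabulate⁺ f₃ (k₂ (inj₂ (∈-tabulate⁻ t (p∩q⊆p (tabulate t) J v∈))) eq)
    ... | false with g₂ .blocked eq
    ...   | w , inj₂ tw , _ , vw =
      contradiction vw (indT (p∩q⊆p (tabulate t) J v∈) (∈-tabulate⁺ t tw))
    ...   | _ , inj₁ (j , j<K , refl) , _ , vj =
      contradiction vj (indJ (p∩q⊆q (tabulate t) J v∈) (q∈J j<K))

  -- The interface between machine and graph theory: the greedy set enters only as some `F` with
  -- these properties, so the combinatorial argument never mentions a run.
  Passes : ℕ → Subset n → (ℕ → Fin n) → Set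
  Passes K T q = ∃[ F ] MaximalIndependent G F × Unrestrained K q T F × ∣ F ∣ ≡ ∣ T ∣

  module _ {K} {T : Subset n} (maxT : MaximalIndependent G T) (passes : ∀ q → Passes K T q) where

    -- Some tuple enumerates `Q`, and its greedy set is the required `F`. This is applied to `J` =
    -- `S` to bound `S ─ T`, and to a maximal independent `J` to reconstruct it.
    exchange : ∀ {Q J} → Independent G J → Q ⊆ J → ∣ Q ∣ ≤ K →
               ∃[ F ] MaximalIndependent G F × Q ⊆ F × T ∩ J ⊆ F × ∣ F ∣ ≡ ∣ T ∣
    exchange {Q} {J} indJ Q⊆J ∣Q∣≤K with 0 <? ∣ Q ∣
    -- The empty set has no entry to repeat and so yields no tuple; `T` itself serves.
    ... | no  0≮ = T , maxT , Q⊆T , p∩q⊆p T J , refl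
      where
      Q⊆T : Q ⊆ T
      Q⊆T x∈ with element-surjective Q x∈
      ... | i , _ = contradiction (≤-trans (s≤s z≤n) (toℕ<n i)) 0≮
    ... | yes 0< with sequence K Q 0< ∣Q∣≤K
    ...   | q , q∈Q , q-onto with passes q
    ...     | F , maxF , unr , ∣F∣≡ with unr J indJ (λ {i} _ → Q⊆J (q∈Q i))
    ...       | q∈F , T∩J⊆F = F , maxF , Q⊆F , T∩J⊆F , ∣F∣≡
      where
      Q⊆F : Q ⊆ F
      Q⊆F x∈ with q-onto x∈
      ... | i , i<K , refl = q∈F i<K

  module _ {ℓ} (P : Partition 1 ℓ G) where
    open Partition P

    stable : Fin n → Bool
    stable v = [ (λ _ → true) , (λ _ → false) ]′ (class v)

    S : Subset n
    S = tabulate stable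

    S-class : ∀ {v} → v ∈ S → class v ≡ inj₁ zero
    S-class {v} v∈ with class v | ∈-tabulate⁻ stable v∈
    ... | inj₁ zero | _ = refl

    S-independent : Independent G S
    S-independent u∈ v∈ = independent zero (S-class u∈) (S-class v∈)

    cliqueOf : ∀ {v} → v ∉ S → ∃[ j ] class v ≡ inj₂ j
    cliqueOf {v} v∉ with class v in eq
    ... | inj₂ j = j , refl
    ... | inj₁ i = contradiction (∈-tabulate⁺ stable (cong [ _ , _ ]′ eq)) v∉

    -- Two vertices of `I` in the same clique would be adjacent, so `I` takes at most one vertex
    -- from each of the ℓ cliques.
    ∣I─S∣≤ℓ : ∀ {I} → Independent G I → ∣ I ─ S ∣ ≤ ℓ
    ∣I─S∣≤ℓ {I} indI = injection⇒∣p∣≤ (I ─ S) clq inj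
      where
      clq : ∀ {x} → x ∈ I ─ S → Fin ℓ
      clq x∈ = proj₁ (cliqueOf (x∈p─q⇒x∉q I S x∈))
      inj : ∀ {x y} (x∈ : x ∈ I ─ S) (y∈ : y ∈ I ─ S) →
            clq x∈ ≡ clq y∈ → x ≡ y
      inj {x} {y} x∈ y∈ eq with x Fin.≟ y
      ... | yes x≡y = x≡y
      ... | no  x≢y = contradiction
        (clique _ (proj₂ (cliqueOf (x∈p─q⇒x∉q I S x∈)))
                  (trans (proj₂ (cliqueOf (x∈p─q⇒x∉q I S y∈))) (cong inj₂ (sym eq))) x≢y)
        (indI (p─q⊆p I S x∈) (p─q⊆p I S y∈))

    module _ {T : Subset n} (maxT : MaximalIndependent G T)
             (passes : ∀ q → Passes (suc (ℓ + ℓ)) T q) where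

      -- Passing from `T` to `F` gains `Q` and loses at most `T ─ S`, which has at most ℓ vertices.
      -- As the sizes agree, `Q` has at most ℓ vertices too.
      ∣S─T∣≤ℓ : ∣ S ─ T ∣ ≤ ℓ
      ∣S─T∣≤ℓ with exchange maxT passes {prune (suc ℓ) (S ─ T)} S-independent
                     (p─q⊆p S T ∘ prune-⊆ (suc ℓ) (S ─ T))
                     -- For ℓ = 0 these ℓ + 1 entries exceed 2ℓ, whence the `suc` in the tuple
                     -- length.
                     (≤-trans (≤-reflexive (∣prune∣ (suc ℓ) (S ─ T)))
                              (≤-trans (m⊓n≤m (suc ℓ) _) (s≤s (m≤m+n ℓ ℓ))))
      ... | F , _ , Q⊆F , T∩S⊆F , ∣F∣≡ = bound (⊓-sel (suc ℓ) ∣ S ─ T ∣)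
        where
        open ≤-Reasoning
        Q : Subset n
        Q = prune (suc ℓ) (S ─ T)
        Q⊆F─T : Q ⊆ F ─ T
        Q⊆F─T x∈ = x∈p∧x∉q⇒x∈p─q (Q⊆F x∈) (x∈p─q⇒x∉q S T (prune-⊆ (suc ℓ) (S ─ T) x∈))
        T∩S⊆F∩T : T ∩ S ⊆ F ∩ T
        T∩S⊆F∩T x∈ = x∈p∩q⁺ (T∩S⊆F x∈ , p∩q⊆p T S x∈)
        ∣Q∣≤ℓ : suc ℓ ⊓ ∣ S ─ T ∣ ≤ ℓ
        ∣Q∣≤ℓ = +-cancelˡ-≤ ∣ T ∩ S ∣ _ _ (begin
          ∣ T ∩ S ∣ + suc ℓ ⊓ ∣ S ─ T ∣  ≡⟨ cong (∣ T ∩ S ∣ +_) (∣prune∣ (suc ℓ) (S ─ T)) ⟨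
          ∣ T ∩ S ∣ + ∣ Q ∣              ≤⟨ +-mono-≤ (p⊆q⇒∣p∣≤∣q∣ T∩S⊆F∩T) (p⊆q⇒∣p∣≤∣q∣ Q⊆F─T) ⟩
          ∣ F ∩ T ∣ + ∣ F ─ T ∣          ≡⟨ ∣p∣≡∣p∩q∣+∣p─q∣ F T ⟨
          ∣ F ∣                          ≡⟨ ∣F∣≡ ⟩
          ∣ T ∣                          ≡⟨ ∣p∣≡∣p∩q∣+∣p─q∣ T S ⟩
          ∣ T ∩ S ∣ + ∣ T ─ S ∣          ≤⟨ +-monoʳ-≤ ∣ T ∩ S ∣ (∣I─S∣≤ℓ (proj₁ maxT)) ⟩
          ∣ T ∩ S ∣ + ℓ                  ∎)
        -- Either pruning left exactly ℓ + 1 elements, which is too many, or it removed nothing and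
        -- the bound on `Q` is the bound on `S ─ T`.
        bound : suc ℓ ⊓ ∣ S ─ T ∣ ≡ suc ℓ ⊎ suc ℓ ⊓ ∣ S ─ T ∣ ≡ ∣ S ─ T ∣ → ∣ S ─ T ∣ ≤ ℓ
        bound (inj₁ eq) = contradiction (≤-trans (≤-reflexive (sym eq)) ∣Q∣≤ℓ) 1+n≰n
        bound (inj₂ eq) = ≤-trans (≤-reflexive (sym eq)) ∣Q∣≤ℓ

      ∣I∣≡∣T∣ : ∀ I → MaximalIndependent G I → ∣ I ∣ ≡ ∣ T ∣
      ∣I∣≡∣T∣ I maxI@(indI , I-maximal)
        with exchange maxT passes {I ─ T} indI (p─q⊆p I T)
               (≤-trans (∣p─r∣≤∣p─q∣+∣q─r∣ I S T)
                        (≤-trans (+-mono-≤ (∣I─S∣≤ℓ indI) ∣S─T∣≤ℓ) (n≤1+n _)))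
      ... | F , (indF , _) , Q⊆F , T∩I⊆F , ∣F∣≡ =
        trans (cong ∣_∣ (⊆-antisym I⊆F (I-maximal F indF I⊆F))) ∣F∣≡
        where
        I⊆F : I ⊆ F
        I⊆F {x} x∈ with x ∈? T
        ... | yes x∈T = T∩I⊆F (x∈p∩q⁺ (x∈T , x∈))
        ... | no  x∉T = Q⊆F (x∈p∧x∉q⇒x∈p─q x∈ x∉T)

      passes⇒wellCovered : WellCovered G
      passes⇒wellCovered I J maxI maxJ = trans (∣I∣≡∣T∣ I maxI) (sym (∣I∣≡∣T∣ J maxJ))

-- Structured programs for random access machines

infixr 5 _⨾_

-- ifz r c runs c if register r is 0; loop r c runs c with r = 0, …, n - 1.
data Cmd : Set where
  skip : Cmd
  op   : Instr → Cmd
  _⨾_  : Cmd → Cmd → Cmd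
  ifz  : ℕ → Cmd → Cmd
  loop : ℕ → Cmd → Cmd

end : Cmd → ℕ → ℕ
end skip       i = i
end (op _)     i = suc i
end (c ⨾ d)    i = end d (end c i)
end (ifz r c)  i = end c (suc i)
end (loop r c) i = 3 + end c (suc i)

-- Conventions of compiled code: register 1 holds 1, register 2 the positive
-- number n of iterations of every loop, and register 15 is overwritten.
compile : ℕ → Cmd → Program
compile i skip       = []
compile i (op x)     = x ∷ []
compile i (c ⨾ d)    = compile i c ++ compile (end c i) d
compile i (ifz r c)  = jump r (end c (suc i)) ∷ compile (suc i) c
compile i (loop r c) = const r 0 ∷ compile (suc i) c ++
                       add r r 1 ∷ sub 15 2 r ∷ jump 15 (suc i) ∷ []

-- An upper bound, not the exact time: an `ifz` is charged in full even when its body is skipped.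
cost : ℕ → Cmd → ℕ
cost n skip       = 0
cost n (op _)     = 1
cost n (c ⨾ d)    = cost n c + cost n d
cost n (ifz r c)  = suc (cost n c)
cost n (loop r c) = suc (n * (cost n c + 3))

end-compile : ∀ c i → length (compile i c) + i ≡ end c i
end-compile skip       i = refl
end-compile (op x)     i = refl
end-compile (c ⨾ d)    i = begin
  length (compile i c ++ compile (end c i) d) + i
    ≡⟨ cong (_+ i) (length-++ (compile i c)) ⟩
  length (compile i c) + length (compile (end c i) d) + i
    ≡⟨ cong (_+ i) (+-comm (length (compile i c)) _) ⟩
  length (compile (end c i) d) + length (compile i c) + i
    ≡⟨ +-assoc (length (compile (end c i) d)) _ i ⟩
  length (compile (end c i) d) + (length (compile i c) + i)
    ≡⟨ cong (length (compile (end c i) d) +_) (end-compile c i) ⟩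
  length (compile (end c i) d) + end c i
    ≡⟨ end-compile d (end c i) ⟩
  end d (end c i) ∎
  where open ≡-Reasoning
end-compile (ifz r c)  i = trans (sym (+-suc (length (compile (suc i) c)) i)) (end-compile c (suc i))
end-compile (loop r c) i = begin
  suc (length (code ++ tail)) + i  ≡⟨ cong (λ l → suc l + i) (length-++ code) ⟩
  suc (length code + 3) + i        ≡⟨ cong (λ l → suc l + i) (+-comm (length code) 3) ⟩
  4 + (length code + i)            ≡⟨ cong (3 +_) (+-suc (length code) i) ⟨
  3 + (length code + suc i)        ≡⟨ cong (3 +_) (end-compile c (suc i)) ⟩
  3 + end c (suc i) ∎
  where
  open ≡-Reasoning
  code tail : Program
  code = compile (suc i) c
  tail = add r r 1 ∷ sub 15 2 r ∷ jump 15 (suc i) ∷ []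

CodeAt : Program → ℕ → Program → Set
CodeAt p i []       = ⊤
CodeAt p i (x ∷ xs) = fetch p i ≡ x × CodeAt p (suc i) xs

codeAt-++ : ∀ p i xs {ys} → CodeAt p i (xs ++ ys) → CodeAt p i xs × CodeAt p (length xs + i) ys
codeAt-++ p i []       at         = tt , at
codeAt-++ p i (x ∷ xs) {ys} (eq , at) with codeAt-++ p (suc i) xs at
... | l , r = (eq , l) , subst (λ j → CodeAt p j ys) (+-suc (length xs) i) r

codeAt-self : ∀ p → CodeAt p 0 p
codeAt-self p = go 0 p (λ j → cong (fetch p) (+-identityʳ j))
  where
  go : ∀ i xs → (∀ j → fetch p (j + i) ≡ fetch xs j) → CodeAt p i xs
  go i []       eq = tt
  go i (x ∷ xs) eq = eq 0 , go (suc i) xs (λ j → trans (cong (fetch p) (+-suc j i)) (eq (suc j)))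

fetch-length : ∀ p → fetch p (length p) ≡ halt
fetch-length []      = refl
fetch-length (x ∷ p) = fetch-length p

run-+ : ∀ p w s t C → run p w (s + t) C ≡ run p w t (run p w s C)
run-+ p w zero    t C = refl
run-+ p w (suc s) t C = run-+ p w s t (step p w C)

≡ᵇ-false : ∀ {a b} → a ≢ b → (a ≡ᵇ b) ≡ false
≡ᵇ-false {a} {b} a≢b with a ≡ᵇ b in eq
... | false = refl
... | true  = contradiction (≡ᵇ⇒≡ a b (subst T (sym eq) tt)) a≢b

update-other : ∀ X {d a x} → a ≢ d → (X [ d ↦ x ]) a ≡ X a
update-other X {d} {a} a≢d rewrite ≡ᵇ-false a≢d = refl

update-same : ∀ X d {x} → (X [ d ↦ x ]) d ≡ x
update-same X d with d ≡ᵇ d in eq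
... | true  = refl
... | false with subst T eq (≡⇒≡ᵇ d d refl)
...   | ()

-- Time-bounded Hoare logic for structured programs

module Semantics (n : ℕ) (w : Word) where

  Reaches : Program → ℕ → Config → Config → Set
  Reaches p b C C′ = ∃[ t ] t ≤ b × run p w t C ≡ C′

  reaches-trans : ∀ {p b b′ C C′ C″} → Reaches p b C C′ → Reaches p b′ C′ C″ →
                  Reaches p (b + b′) C C″
  reaches-trans {p} {C = C} (s , s≤ , refl) (t , t≤ , eq) =
    s + t , +-mono-≤ s≤ t≤ , trans (run-+ p w s t C) eq

  reaches-≤ : ∀ {p b b′ C C′} → b ≤ b′ → Reaches p b C C′ → Reaches p b′ C C′
  reaches-≤ b≤ (t , t≤ , eq) = t , ≤-trans t≤ b≤ , eq

  reaches-step : ∀ {p i X x C′} → fetch p i ≡ x → exec w x ⟨ i , X ⟩ ≡ C′ →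
                 Reaches p 1 ⟨ i , X ⟩ C′
  reaches-step {i = i} {X} at eq = 1 , ≤-refl , trans (cong (λ x → exec w x ⟨ i , X ⟩) at) eq

  -- Quantifying over all programs that contain the code at any address makes executions composable.
  -- Being a record, it lets `c`, `X` and `Y` be inferred from its type.
  record Exec (c : Cmd) (X Y : Registers) : Set where
    constructor mkExec
    field
      reaches : ∀ p i → CodeAt p i (compile i c) →
                Reaches p (cost n c) ⟨ i , X ⟩ ⟨ end c i , Y ⟩
  open Exec public

  exec-skip : ∀ {X} → Exec skip X X
  exec-skip .reaches p i _ = 0 , z≤n , refl

  exec-op : ∀ {x X Y} → (∀ i → exec w x ⟨ i , X ⟩ ≡ ⟨ suc i , Y ⟩) → Exec (op x) X Y
  exec-op eq .reaches p i (at , _) = reaches-step at (eq i)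

  exec-const : ∀ d c {X} → Exec (op (const d c)) X (X [ d ↦ c ])
  exec-const d c = exec-op λ _ → refl

  -- Results enter through equations, so that the updated registers show mathematical values instead
  -- of register expressions.
  exec-add : ∀ d r s {X x} → X r + X s ≡ x → Exec (op (add d r s)) X (X [ d ↦ x ])
  exec-add d r s refl = exec-op λ _ → refl

  exec-sub : ∀ d r s {X x} → X r ∸ X s ≡ x → Exec (op (sub d r s)) X (X [ d ↦ x ])
  exec-sub d r s refl = exec-op λ _ → refl

  exec-load : ∀ d r {X a x} → X r ≡ a → X a ≡ x → Exec (op (load d r)) X (X [ d ↦ x ])
  exec-load d r refl refl = exec-op λ _ → refl

  exec-store : ∀ d r {X a x} → X d ≡ a → X r ≡ x → Exec (op (store d r)) X (X [ a ↦ x ])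
  exec-store d r refl refl = exec-op λ _ → refl

  exec-read : ∀ d r {X a x} → X r ≡ a → inputAt w a ≡ x → Exec (op (read d r)) X (X [ d ↦ x ])
  exec-read d r refl refl = exec-op λ _ → refl

  infixr 5 _▸_
  _▸_ : ∀ {c d X Y Z} → Exec c X Y → Exec d Y Z → Exec (c ⨾ d) X Z
  _▸_ {c} {d} e f .reaches p i at with codeAt-++ p i (compile i c) at
  ... | at₁ , at₂ = reaches-trans (e .reaches p i at₁)
    (f .reaches p (end c i) (subst (λ j → CodeAt p j (compile (end c i) d)) (end-compile c i) at₂))

  exec-ifz-yes : ∀ {r c X Y} → X r ≡ 0 → Exec c X Y → Exec (ifz r c) X Y
  exec-ifz-yes {r} {c} {X} eq e .reaches p i (at , at′) = reaches-trans
    (reaches-step at (cong (λ x → ⟨ if x ≡ᵇ 0 then suc i else end c (suc i) , X ⟩) eq))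
    (e .reaches p (suc i) at′)

  exec-ifz-no : ∀ {r c X} → X r ≢ 0 → Exec (ifz r c) X X
  exec-ifz-no {r} {c} {X} neq .reaches p i (at , _) = reaches-≤ (s≤s z≤n)
    (reaches-step at (cong (λ b → ⟨ if b then suc i else end c (suc i) , X ⟩) (≡ᵇ-false neq)))

  -- Total correctness; the time bound is hidden in `Exec`.
  Triple : (Registers → Set) → Cmd → (Registers → Set) → Set
  Triple P c Q = ∀ {X} → P X → ∃[ Y ] Exec c X Y × Q Y

  exec-map : ∀ {c X} {Q R : Registers → Set} → (∀ {Y} → Q Y → R Y) →
             ∃[ Y ] Exec c X Y × Q Y → ∃[ Y ] Exec c X Y × R Y
  exec-map f (Y , e , q) = Y , e , f q

  exec-seq : ∀ {c d P Q R} → Triple P c Q → Triple Q d R → Triple P (c ⨾ d) R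
  exec-seq t u p = let Y , e , q = t p ; Z , f , r = u q in Z , e ▸ f , r

  -- The loop rule. Besides the body, a loop writes only its counter `r` and register 15, so the
  -- invariant must survive these two writes, and the body must leave the counter as it found it.
  module _ (r : ℕ) (c : Cmd) (Inv : ℕ → Registers → Set)
           (one : ∀ {k X} → Inv k X → X 1 ≡ 1) (size : ∀ {k X} → Inv k X → X 2 ≡ n)
           (stable-r : ∀ {k X x} → Inv k X → Inv k (X [ r ↦ x ]))
           (stable-15 : ∀ {k X x} → Inv k X → Inv k (X [ 15 ↦ x ]))
           (r≢15 : r ≢ 15)
           (body : ∀ {k} → k < n → Triple (λ X → X r ≡ k × Inv k X) c (λ X → X r ≡ k × Inv (suc k) X))
           where

    private
      Iterates : ℕ → Registers → Registers → Set
      Iterates m X Y = ∀ p i → CodeAt p i (compile i (loop r c)) →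
        Reaches p (m * (cost n c + 3)) ⟨ suc i , X ⟩ ⟨ end (loop r c) i , Y ⟩

      module Round {k X Y} (inv : Inv (suc k) Y) (Yr≡k : Y r ≡ k) (e : Exec c X Y) where
        Y₁ Y₂ : Registers
        Y₁ = Y [ r ↦ suc k ]
        Y₂ = Y₁ [ 15 ↦ n ∸ suc k ]
        Y₂r : Y₂ r ≡ suc k
        Y₂r = trans (update-other Y₁ r≢15) (update-same Y r)
        Y₂-inv : Inv (suc k) Y₂
        Y₂-inv = stable-15 (stable-r inv)
        -- Here `d` is the number of rounds left, as held in register 15. Keeping it a variable lets
        -- the final conditional jump compute once `d` is replaced by 0 or a successor.
        round : ∀ {d} → n ∸ suc k ≡ d → ∀ p i → CodeAt p i (compile i (loop r c)) →
                Reaches p (cost n c + 3) ⟨ suc i , X ⟩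
                        ⟨ (if d ≡ᵇ 0 then end (loop r c) i else suc i) , Y₂ ⟩
        round refl p i (at , ats)
          with codeAt-++ p (suc i) (compile (suc i) c) ats
        ... | atc , att
          with subst (λ j → CodeAt p j (add r r 1 ∷ sub 15 2 r ∷ jump 15 (suc i) ∷ []))
                     (end-compile c (suc i)) att
        ... | at₁ , at₂ , at₃ , _ =
          reaches-trans (e .reaches p (suc i) atc)
            (reaches-trans (reaches-step at₁ (cong (λ x → ⟨ suc j , Y [ r ↦ x ] ⟩) k+1))
            (reaches-trans (reaches-step at₂ (cong (λ x → ⟨ 2 + j , Y₁ [ 15 ↦ x ] ⟩)
                                                   (cong₂ _∸_ (size (stable-r inv)) (update-same Y r))))
            (reaches-step at₃ refl)))
          where
          j : ℕ
          j = end c (suc i)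
          k+1 : Y r + Y 1 ≡ suc k
          k+1 = trans (cong₂ _+_ Yr≡k (one inv)) (+-comm k 1)

      iterate : ∀ m {k X} → suc m + k ≡ n → X r ≡ k → Inv k X →
                ∃[ Y ] Iterates (suc m) X Y × Inv n Y
      iterate m {k} eq Xr≡k inv
        with body (≤-trans (s≤s (m≤n+m k m)) (≤-reflexive eq)) (Xr≡k , inv)
      iterate zero {k} refl Xr≡k inv | Y , e , Yr≡k , inv′ =
        Y₂ , (λ p i at → reaches-≤ (≤-reflexive (sym (+-identityʳ _))) (round (n∸n≡0 (suc k)) p i at)) , Y₂-inv
        where open Round inv′ Yr≡k e
      iterate (suc m) {k} eq Xr≡k inv | Y , e , Yr≡k , inv′
        with iterate m (trans (+-suc (suc m) k) eq) (Round.Y₂r inv′ Yr≡k e) (Round.Y₂-inv inv′ Yr≡k e)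
      ... | Z , rest , invZ =
        Z , (λ p i at → reaches-trans (round left p i at) (rest p i at)) , invZ
        where
        open Round inv′ Yr≡k e
        left : n ∸ suc k ≡ suc m
        left = trans (cong (_∸ suc k) (sym (trans (+-suc (suc m) k) eq))) (m+n∸n≡m (suc m) (suc k))

    -- The test stands at the bottom of the compiled loop, so the body always runs at least once;
    -- hence the condition on `n`.
    exec-loop : 0 < n → Triple (Inv 0) (loop r c) (Inv n)
    exec-loop 0<n {X} inv
      with iterate (pred n) (trans (+-identityʳ _) (suc-pred n {{>-nonZero 0<n}})) (update-same X r) (stable-r inv)
    ... | Y , iters , invY = Y , mkExec reach , invY
      where
      reach : ∀ p i → CodeAt p i (compile i (loop r c)) →
              Reaches p (suc (n * (cost n c + 3))) ⟨ i , X ⟩ ⟨ end (loop r c) i , Y ⟩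
      reach p i at = reaches-trans (reaches-step (proj₁ at) refl)
        (subst (λ m → Reaches p (m * (cost n c + 3)) _ _) (suc-pred n {{>-nonZero 0<n}}) (iters p i at))

-- Polynomial bounds on the running time

degree coefficient : Cmd → ℕ
degree skip           = 0
degree (op _)         = 0
degree (c ⨾ d)        = degree c + degree d
degree (ifz r c)      = degree c
degree (loop r c)     = suc (degree c)
coefficient skip       = 0
coefficient (op _)     = 1
coefficient (c ⨾ d)    = coefficient c + coefficient d
coefficient (ifz r c)  = suc (coefficient c)
coefficient (loop r c) = coefficient c + 4

-- One monomial suffices because powers of a positive `M` are monotone in the exponent: adding
-- degrees under `⨾` is a crude maximum. The 4 for a loop is 3 steps of overhead per round plus the
-- initialisation. `M` will be the length of the input.
cost-polynomial : ∀ {n M} → n ≤ M → 0 < M → ∀ c → cost n c ≤ coefficient c * M ^ degree c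
cost-polynomial {n} {M} n≤M 0<M = bound
  where
  open ≤-Reasoning
  instance
    M≢0 : NonZero M
    M≢0 = >-nonZero 0<M
  1≤M^ : ∀ d → 1 ≤ M ^ d
  1≤M^ d = >-nonZero⁻¹ (M ^ d) {{m^n≢0 M d}}
  const≤ : ∀ a d → a ≤ a * M ^ d
  const≤ a d = m≤m*n a (M ^ d) {{>-nonZero (1≤M^ d)}}
  bound : ∀ c → cost n c ≤ coefficient c * M ^ degree c
  bound skip       = z≤n
  bound (op _)     = ≤-refl
  bound (c ⨾ d)    = begin
    cost n c + cost n d
      ≤⟨ +-mono-≤ (bound c) (bound d) ⟩
    coefficient c * M ^ degree c + coefficient d * M ^ degree d
      ≤⟨ +-mono-≤ (*-monoʳ-≤ (coefficient c) (^-monoʳ-≤ M (m≤m+n (degree c) (degree d))))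
                  (*-monoʳ-≤ (coefficient d) (^-monoʳ-≤ M (m≤n+m (degree d) (degree c)))) ⟩
    coefficient c * M ^ (degree c + degree d) + coefficient d * M ^ (degree c + degree d)
      ≡⟨ *-distribʳ-+ (M ^ (degree c + degree d)) (coefficient c) _ ⟨
    (coefficient c + coefficient d) * M ^ (degree c + degree d) ∎
  bound (ifz r c)  = +-mono-≤ (1≤M^ (degree c)) (bound c)
  bound (loop r c) = begin
    1 + n * (cost n c + 3)
      ≤⟨ +-mono-≤ (1≤M^ (suc (degree c))) (*-mono-≤ n≤M (+-mono-≤ (bound c) (const≤ 3 (degree c)))) ⟩
    M ^ suc (degree c) + M * (coefficient c * M ^ degree c + 3 * M ^ degree c)
      ≡⟨ cong (λ x → M ^ suc (degree c) + M * x) (*-distribʳ-+ (M ^ degree c) (coefficient c) 3) ⟨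
    M ^ suc (degree c) + M * ((coefficient c + 3) * M ^ degree c)
      ≡⟨ cong (M ^ suc (degree c) +_) (x∙yz≈y∙xz *-commutativeSemigroup M (coefficient c + 3) (M ^ degree c)) ⟩
    M ^ suc (degree c) + (coefficient c + 3) * M ^ suc (degree c)
      ≡⟨ cong (_* M ^ suc (degree c)) (+-suc (coefficient c) 3) ⟨
    (coefficient c + 4) * M ^ suc (degree c) ∎

-- The algorithm and its correctness

inputAt-tabulate : ∀ {m x} (f : Fin m → ℕ) i → inputAt (x List.∷ List.tabulate f) (suc (toℕ i)) ≡ f i
inputAt-tabulate f zero    = refl
inputAt-tabulate f (suc i) = inputAt-tabulate {x = f zero} (f ∘ suc) i

inputAt-adj : ∀ {n} (G : Graph n) u v →
              inputAt (encode G) (suc (n * toℕ u + toℕ v)) ≡ bit (adj G u v)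
inputAt-adj {n} G u v = begin
  inputAt (encode G) (suc (n * toℕ u + toℕ v))
    ≡⟨ cong (inputAt (encode G) ∘ suc) (toℕ-combine u v) ⟨
  inputAt (encode G) (suc (toℕ (combine u v)))
    ≡⟨ inputAt-tabulate {x = n} _ (combine u v) ⟩
  _ ≡⟨ cong (uncurry (λ x y → bit (adj G x y))) (remQuot-combine u v) ⟩
  bit (adj G u v) ∎
  where open ≡-Reasoning

-- Adding an adjacency bit to a counter does to "the counter is 0" what `try` does to `f`.
bit-blocks : ∀ x b → (x + bit b ≡ᵇ 0) ≡ (x ≡ᵇ 0) ∧ not b
bit-blocks zero    true  = refl
bit-blocks zero    false = refl
bit-blocks (suc x) b     = refl

-- Replaces the value of `F` at `b`. One statement then covers a run in either array while the other
-- array is held fixed.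
assign : {A : Set} → Bool → A → (Bool → A) → Bool → A
assign false g F false = g
assign false g F true  = F true
assign true  g F false = F false
assign true  g F true  = g

assign-same : ∀ {A : Set} b {g : A} F → assign b g F b ≡ g
assign-same false F = refl
assign-same true  F = refl

assign-cong : ∀ {n} b {g g′ : Fin n → Bool} {F} → g ≗ g′ → ∀ b′ → assign b g F b′ ≗ assign b g′ F b′
assign-cong false eq false = eq
assign-cong false eq true  _ = refl
assign-cong true  eq false _ = refl
assign-cong true  eq true  = eq

assign-self : ∀ {A : Set} b (F : Bool → A) b′ → F b′ ≡ assign b (F b) F b′
assign-self false F false = refl
assign-self false F true  = refl
assign-self true  F false = refl
assign-self true  F true  = refl

-- Register use: 0 the answer, 1 the number 1, 2 the number n, 6 the number 0,
-- 7 and 8 the current vertices, 9 an input address, 10–15 scratch, and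
-- 16 + i the entry q i.  Two arrays, with base addresses in registers 4 and 5,
-- count for every vertex its chosen neighbours in the run that computes T
-- (false) and in the current run (true).  A vertex is free if its count is 0,
-- and at the end of a run the free vertices are the chosen ones.
baseReg : Bool → ℕ
baseReg false = 4
baseReg true  = 5

whenFree : Bool → Cmd → Cmd
whenFree b c = op (add 10 (baseReg b) 7) ⨾ op (load 11 10) ⨾ ifz 11 c

-- The input is read down column `v` of the matrix: register 9 starts at 1 + v and grows by n per
-- row, since the machine cannot multiply.
block : Bool → Cmd
block b = op (read 12 9) ⨾ op (add 10 (baseReg b) 8) ⨾ op (load 11 10) ⨾
          op (add 11 11 12) ⨾ op (store 10 11) ⨾ op (add 9 9 2)

tryCmd : Bool → Cmd
tryCmd b = whenFree b (op (add 9 1 7) ⨾ loop 8 (block b))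

reset : Cmd
reset = loop 7 (op (add 10 5 7) ⨾ op (store 10 6))

tryTuple : ℕ → Cmd
tryTuple zero    = skip
-- Adding register 6, which holds 0, copies a register.
tryTuple (suc k) = tryTuple k ⨾ op (add 7 (16 + k) 6) ⨾ tryCmd true

tally : Cmd
tally = op (const 13 0) ⨾ op (const 14 0) ⨾
        loop 7 (whenFree false (op (add 13 13 1)) ⨾ whenFree true (op (add 14 14 1)))

-- The sum of the two truncated differences is the distance between the sizes; 1 minus it,
-- truncated, is 0 exactly when the sizes differ.
judge : Cmd
judge = op (sub 11 13 14) ⨾ op (sub 12 14 13) ⨾ op (add 11 11 12) ⨾
        op (sub 11 1 11) ⨾ ifz 11 (op (const 0 0))

greedyRun : ℕ → Cmd
greedyRun K = reset ⨾ tryTuple K ⨾ loop 7 (whenFree false (tryCmd true)) ⨾ loop 7 (tryCmd true)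

test : ℕ → Cmd
test K = greedyRun K ⨾ tally ⨾ judge

-- The nesting depth is fixed at compile time, so the number of tuples contributes to the degree of
-- the time bound. Outer loops fix the entries of higher index.
forTuples : ℕ → Cmd → Cmd
forTuples zero    c = c
forTuples (suc k) c = loop (16 + k) (forTuples k c)

-- Registers start at 0, so `read 2 6` fetches the vertex count and the array of `T` needs no reset.
-- Register 11 gets 1 ∸ n, nonzero only for the empty graph, which skips the loops and keeps the
-- answer 1.
main : ℕ → Cmd
main K = op (const 1 1) ⨾ op (read 2 6) ⨾ op (const 4 (16 + K)) ⨾ op (add 5 4 2) ⨾
         op (const 0 1) ⨾ op (sub 11 1 2) ⨾
         ifz 11 (loop 7 (tryCmd false) ⨾ forTuples K (test K))

-- Memory layout and verification of the greedy runs

module Spec {n} (G : Graph n) (0<n : 0 < n) (K : ℕ) where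

  open Semantics n (encode G)

  base : Bool → ℕ
  base false = 16 + K
  base true  = 16 + K + n

  cell : Bool → Fin n → ℕ
  cell b v = base b + toℕ v

  16+K≤cell : ∀ b v → 16 + K ≤ cell b v
  16+K≤cell false v = m≤m+n _ _
  16+K≤cell true  v = ≤-trans (m≤m+n _ _) (m≤m+n _ _)

  cell-high : ∀ b v {a} → a < 16 + K → a ≢ cell b v
  cell-high b v a< = <⇒≢ (≤-trans a< (16+K≤cell b v))

  cell-low : ∀ b v {a} → a < 16 → a ≢ cell b v
  cell-low b v a< = cell-high b v (≤-trans a< (m≤m+n 16 K))

  cell-injective : ∀ b v v′ → cell b v ≡ cell b v′ → v ≡ v′
  cell-injective b v v′ eq = toℕ-injective (+-cancelˡ-≡ (base b) _ _ eq)

  cell-disjoint : ∀ v v′ → cell false v ≢ cell true v′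
  cell-disjoint v v′ = <⇒≢ (≤-trans (+-monoʳ-< (base false) (toℕ<n v)) (m≤m+n _ (toℕ v′)))

  -- Only the entries q k, …, q (K - 1) have been fixed by the enclosing loops.
  record State (k : ℕ) (q : ℕ → Fin n) (a : ℕ) (F : Bool → Fin n → Bool) (X : Registers) : Set where
    field
      answer : X 0 ≡ a
      one    : X 1 ≡ 1
      size   : X 2 ≡ n
      bases  : ∀ b → X (baseReg b) ≡ base b
      zer    : X 6 ≡ 0
      tuple  : ∀ {i} → k ≤ i → i < K → X (16 + i) ≡ toℕ (q i)
      free   : ∀ b v → (X (cell b v) ≡ᵇ 0) ≡ F b v
  open State

  private variable
    k   : ℕ
    q   : ℕ → Fin n
    a   : ℕ
    F F′ : Bool → Fin n → Bool
    X   : Registers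

  state-≗ : (∀ b → F b ≗ F′ b) → State k q a F X → State k q a F′ X
  state-≗ eq s = record
    { answer = s .answer ; one = s .one ; size = s .size ; bases = s .bases ; zer = s .zer
    ; tuple = s .tuple ; free = λ b v → trans (s .free b v) (eq b v) }

  -- For a literal `d` the two range conditions compute to the unit type and are solved silently.
  scratch : ∀ d {x} {_ : T (6 <ᵇ d)} {_ : T (d <ᵇ 16)} →
            State k q a F X → State k q a F (X [ d ↦ x ])
  scratch {k} {q} {a} {F} {X} d {x} {l} {h} s = record
    { answer = keep (s .answer) ; one = keep (s .one) ; size = keep (s .size)
    ; bases = λ { false → keep (s .bases false) ; true → keep (s .bases true) }
    ; zer = keep (s .zer)
    ; tuple = λ k≤ i< → trans (update-other X (>⇒≢ (≤-trans d<16 (m≤m+n 16 _)))) (s .tuple k≤ i<)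
    ; free = λ b v → trans (cong (_≡ᵇ 0) (update-other X (≢-sym (cell-low b v d<16)))) (s .free b v)
    }
    where
    d<16 : d < 16
    d<16 = <ᵇ⇒< d 16 h
    keep : ∀ {r y} {r≤ : T (r ≤ᵇ 6)} → X r ≡ y → (X [ d ↦ x ]) r ≡ y
    keep {r} {r≤ = r≤} eq = trans (update-other X (<⇒≢ (≤-<-trans (≤ᵇ⇒≤ r 6 r≤) (<ᵇ⇒< 6 d l)))) eq

  cell-write : ∀ b v x → State k q a F X → F′ b v ≡ (x ≡ᵇ 0) →
               (∀ {u} → u ≢ v → F′ b u ≡ F b u) → (∀ b′ → b′ ≢ b → F′ b′ ≗ F b′) →
               State k q a F′ (X [ cell b v ↦ x ])
  cell-write {k} {q} {a} {F} {X} {F′} b v x s eq others same = record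
    { answer = keep (s .answer) ; one = keep (s .one) ; size = keep (s .size)
    ; bases = λ { false → keep (s .bases false) ; true → keep (s .bases true) }
    ; zer = keep (s .zer)
    ; tuple = λ k≤ i< → trans (update-other X (cell-high b v (+-monoʳ-< 16 i<))) (s .tuple k≤ i<)
    ; free = free′
    }
    where
    keep : ∀ {r y} {r< : T (r <ᵇ 16)} → X r ≡ y → (X [ cell b v ↦ x ]) r ≡ y
    keep {r} {r< = r<} e = trans (update-other X (cell-low b v (<ᵇ⇒< r 16 r<))) e
    other-array : ∀ b′ → b′ ≢ b → ∀ u → cell b′ u ≢ cell b v
    other-array false b′≢b u = case-b b b′≢b
      where
      case-b : ∀ b → false ≢ b → cell false u ≢ cell b v
      case-b false ne = contradiction refl ne
      case-b true  _  = cell-disjoint u v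
    other-array true b′≢b u = case-b b b′≢b
      where
      case-b : ∀ b → true ≢ b → cell true u ≢ cell b v
      case-b true  ne = contradiction refl ne
      case-b false _  = ≢-sym (cell-disjoint v u)
    free′ : ∀ b′ u → ((X [ cell b v ↦ x ]) (cell b′ u) ≡ᵇ 0) ≡ F′ b′ u
    free′ b′ u with b′ Bool.≟ b
    ... | no b′≢b = trans (cong (_≡ᵇ 0) (update-other X (other-array b′ b′≢b u)))
                          (trans (s .free b′ u) (sym (same b′ b′≢b u)))
    ... | yes refl with u Fin.≟ v
    ...   | yes refl = trans (cong (_≡ᵇ 0) (update-same X (cell b v))) (sym eq)
    ...   | no  u≢v  = trans (cong (_≡ᵇ 0) (update-other X (u≢v ∘ cell-injective b u v)))
                             (trans (s .free b u) (sym (others u≢v)))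

  assign-write : ∀ b v x {g g′} → State k q a (assign b g F) X → g′ v ≡ (x ≡ᵇ 0) →
                 (∀ {u} → u ≢ v → g′ u ≡ g u) → State k q a (assign b g′ F) (X [ cell b v ↦ x ])
  assign-write {F = F} false v x s eq others = cell-write false v x s eq others
    λ { false ne → contradiction refl ne ; true _ _ → refl }
  assign-write {F = F} true v x s eq others = cell-write true v x s eq others
    λ { true ne → contradiction refl ne ; false _ _ → refl }

  -- Loop counters are natural numbers below n; this lets loop bodies be specified for vertices.
  by-vertex : ∀ {P Q : ℕ → Registers → Set} {c} → (∀ v → Triple (P (toℕ v)) c (Q (toℕ v))) →
              ∀ {k} → k < n → Triple (P k) c (Q k)
  by-vertex {P} {Q} {c} t k<n = subst (λ j → Triple (P j) c (Q j)) (toℕ-fromℕ< k<n) (t (fromℕ< k<n))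

  exec-whenFree : ∀ b c v {P Q : Registers → Set} →
    (∀ {X} → P X → State k q a F X × X 7 ≡ toℕ v) →
    (∀ {X x} → P X → P (X [ 10 ↦ x ])) → (∀ {X x} → P X → P (X [ 11 ↦ x ])) →
    (F b v ≡ true → Triple P c Q) → (F b v ≡ false → ∀ {X} → P X → Q X) →
    Triple P (whenFree b c) Q
  exec-whenFree {F = F} b c v {P} {Q} state stable₁ stable₂ yes-free no-free {X} p
    with F b v in eq
  ... | true  = let Z , e , z = yes-free refl pY in
      Z , loads ▸ exec-load 11 10 refl refl ▸ exec-ifz-yes value e , z
    where
    Y : Registers
    Y = X [ 10 ↦ cell b v ]
    loads : Exec (op (add 10 (baseReg b) 7)) X Y
    loads = exec-add 10 (baseReg b) 7 (cong₂ _+_ (state p .proj₁ .bases b) (state p .proj₂))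
    pY : P (Y [ 11 ↦ Y (cell b v) ])
    pY = stable₂ (stable₁ p)
    value : Y (cell b v) ≡ 0
    value = ≡ᵇ⇒≡ _ 0 (adjacent (trans (state (stable₁ p) .proj₁ .free b v) eq))
  ... | false = _ , loads ▸ exec-load 11 10 refl refl ▸ exec-ifz-no value , no-free refl pY
    where
    Y : Registers
    Y = X [ 10 ↦ cell b v ]
    loads : Exec (op (add 10 (baseReg b) 7)) X Y
    loads = exec-add 10 (baseReg b) 7 (cong₂ _+_ (state p .proj₁ .bases b) (state p .proj₂))
    pY : P (Y [ 11 ↦ Y (cell b v) ])
    pY = stable₂ (stable₁ p)
    value : Y (cell b v) ≢ 0
    value eq0 with trans (sym (trans (state (stable₁ p) .proj₁ .free b v) eq)) (cong (_≡ᵇ 0) eq0)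
    ... | ()

  module _ (v : Fin n) (g : Fin n → Bool) where

    -- The array in the middle of the blocking loop, when only the vertices below `k` have received
    -- their adjacency bit.
    partial : ℕ → Fin n → Bool
    partial k u = if does (toℕ u <? k) then g u ∧ not (adj G u v) else g u

    partial-new : ∀ u → partial (suc (toℕ u)) u ≡ g u ∧ not (adj G u v)
    partial-new u rewrite dec-true (toℕ u <? suc (toℕ u)) ≤-refl = refl

    partial-cur : ∀ u → partial (toℕ u) u ≡ g u
    partial-cur u rewrite dec-false (toℕ u <? toℕ u) (<-irrefl refl) = refl

    partial-old : ∀ u {x} → x ≢ u → partial (suc (toℕ u)) x ≡ partial (toℕ u) x
    partial-old u {x} x≢u with toℕ x <? toℕ u
    ... | yes x<u rewrite dec-true (toℕ x <? toℕ u) x<u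
                        | dec-true (toℕ x <? suc (toℕ u)) (m<n⇒m<1+n x<u) = refl
    ... | no  x≮u rewrite dec-false (toℕ x <? toℕ u) x≮u
                        | dec-false (toℕ x <? suc (toℕ u))
                      (λ x< → x≮u (≤∧≢⇒< (s≤s⁻¹ x<) (x≢u ∘ toℕ-injective))) = refl

    partial-all : ∀ u → partial n u ≡ g u ∧ not (adj G u v)
    partial-all u rewrite dec-true (toℕ u <? n) (toℕ<n u) = refl

    module _ (b : Bool) where

      Blocking : ℕ → (ℕ → Fin n) → ℕ → (Bool → Fin n → Bool) → ℕ → Registers → Set
      Blocking k q a F j X = State k q a (assign b (partial j) F) X ×
                             X 7 ≡ toℕ v × X 9 ≡ suc (n * j + toℕ v)

      exec-block : ∀ u → Triple (λ X → X 8 ≡ toℕ u × Blocking k q a F (toℕ u) X) (block b)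
                                (λ X → X 8 ≡ toℕ u × Blocking k q a F (suc (toℕ u)) X)
      exec-block {F = F} u {X} (X8 , s , X7 , X9) =
        _ , exec-read 12 9 X9 (inputAt-adj G u v)
          ▸ exec-add 10 (baseReg b) 8 (cong₂ _+_ (s₁ .bases b) X8)
          ▸ exec-load 11 10 {X₂} refl refl
          ▸ exec-add 11 11 12 {X₃} refl
          ▸ exec-store 10 11 {X₄} refl refl
          ▸ exec-add 9 9 2 {X₅} (trans (cong₂ _+_ (trans (low 9) X9) (s₅ .size)) next)
        , trans (low 8) X8 , scratch 9 s₅ , trans (low 7) X7 , refl
        where
        X₁ X₂ X₃ X₄ X₅ : Registers
        X₁ = X [ 12 ↦ bit (adj G u v) ]
        X₂ = X₁ [ 10 ↦ cell b u ]
        x : ℕ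
        x = X₂ (cell b u)
        X₃ = X₂ [ 11 ↦ x ]
        X₄ = X₃ [ 11 ↦ x + bit (adj G u v) ]
        X₅ = X₄ [ cell b u ↦ x + bit (adj G u v) ]
        s₁ = scratch 12 s
        s₂ = scratch 10 s₁
        s₄ = scratch 11 (scratch 11 s₂)
        s₅ : State _ _ _ (assign b (partial (suc (toℕ u))) F) X₅
        s₅ = assign-write b u _ s₄
          (trans (partial-new u) (trans (cong (_∧ not (adj G u v)) x-free) (sym (bit-blocks x (adj G u v)))))
          (partial-old u)
          where
          x-free : g u ≡ (x ≡ᵇ 0)
          x-free = trans (sym (partial-cur u))
            (trans (sym (cong (λ h → h u) (assign-same b F))) (sym (s₂ .free b u)))
        low : ∀ r {r< : T (r <ᵇ 16)} → X₅ r ≡ X₄ r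
        low r {r<} = update-other X₄ (cell-low b u (<ᵇ⇒< r 16 r<))
        next : suc (n * toℕ u + toℕ v) + n ≡ suc (n * suc (toℕ u) + toℕ v)
        next = cong suc (begin
          n * toℕ u + toℕ v + n   ≡⟨ +-comm _ n ⟩
          n + (n * toℕ u + toℕ v) ≡⟨ +-assoc n _ _ ⟨
          n + n * toℕ u + toℕ v   ≡⟨ cong (_+ toℕ v) (*-suc n (toℕ u)) ⟨
          n * suc (toℕ u) + toℕ v ∎)
          where open ≡-Reasoning

      exec-try : Triple (λ X → X 7 ≡ toℕ v × State k q a (assign b g F) X) (tryCmd b)
                        (λ X → X 7 ≡ toℕ v × State k q a (assign b (try G v g) F) X)
      exec-try {k} {q} {a} {F} = exec-whenFree b _ v {P} {Q}
        (λ (X7 , s) → s , X7)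
        (λ (X7 , s) → X7 , scratch 10 s) (λ (X7 , s) → X7 , scratch 11 s)
        (λ gv → block-all (trans (sym same) gv))
        (λ gv (X7 , s) → X7 , state-≗ (assign-cong b λ u → sym (skipped u (trans (sym same) gv))) s)
        where
        P Q : Registers → Set
        P X = X 7 ≡ toℕ v × State k q a (assign b g F) X
        Q X = X 7 ≡ toℕ v × State k q a (assign b (try G v g) F) X
        same : assign b g F b v ≡ g v
        same = cong (λ h → h v) (assign-same b F)
        skipped : ∀ u → g v ≡ false → try G v g u ≡ g u
        skipped u gv rewrite gv = refl
        block-all : g v ≡ true → Triple P (op (add 9 1 7) ⨾ loop 8 (block b)) Q
        block-all gv {X} (X7 , s)
          with exec-loop 8 (block b) (Blocking k q a F)
                 (λ (s , _) → s .one) (λ (s , _) → s .size)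
                 (λ (s , X7 , X9) → scratch 8 s , X7 , X9) (λ (s , X7 , X9) → scratch 15 s , X7 , X9)
                 (λ ())
                 (by-vertex {λ j X → X 8 ≡ j × Blocking k q a F j X}
                            {λ j X → X 8 ≡ j × Blocking k q a F (suc j) X} exec-block)
                 0<n {X [ 9 ↦ suc (toℕ v) ]}
                 (scratch 9 s , X7 , cong (λ x → suc (x + toℕ v)) (sym (*-zeroʳ n)))
        ... | Y , e , sY , Y7 , _ = Y , exec-add 9 1 7 (cong₂ _+_ (s .one) X7) ▸ e ,
          Y7 , state-≗ (assign-cong b λ u → trans (partial-all u) (tried u)) sY
          where
          tried : ∀ u → g u ∧ not (adj G u v) ≡ try G v g u
          tried u rewrite gv = refl

  -- `C` is `T` in the pass that tries the vertices of `T` again, and everything in the pass that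
  -- computes `T` and in the one that completes a run.
  exec-pass : ∀ b c (C : Fin n → Bool) {k q a F} →
    (∀ g v → Triple (λ X → X 7 ≡ toℕ v × State k q a (assign b g F) X) c
                    (λ X → X 7 ≡ toℕ v × State k q a (assign b (if C v then try G v g else g) F) X)) →
    ∀ {D f} → Greedy G D f →
    Triple (State k q a (assign b f F)) (loop 7 c)
           (λ X → ∃[ f′ ] State k q a (assign b f′ F) X ×
                          Greedy G (λ v → D v ⊎ C v ≡ true) f′ × Keeps D f f′)
  exec-pass b c C {k} {q} {a} {F} step {D} {f} greedy s
    with exec-loop 7 c Inv (λ (_ , s , _) → s .one) (λ (_ , s , _) → s .size)
           (λ (g , s , r) → g , scratch 7 s , r) (λ (g , s , r) → g , scratch 15 s , r) (λ ())
           (by-vertex {λ j X → X 7 ≡ j × Inv j X} {λ j X → X 7 ≡ j × Inv (suc j) X} body) 0<n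
           (f , s , greedy-⇔ G inj₁ (λ { (inj₁ Dv) → Dv }) greedy , λ _ fv → fv)
    where
    Tried : ℕ → Fin n → Set
    Tried j v = D v ⊎ toℕ v < j × C v ≡ true
    Inv : ℕ → Registers → Set
    Inv j X = ∃[ g ] State k q a (assign b g F) X × Greedy G (Tried j) g × Keeps D f g
    later : ∀ {u v} → Tried (toℕ v) u → Tried (suc (toℕ v)) u
    later (inj₁ Du)        = inj₁ Du
    later (inj₂ (u< , Cu)) = inj₂ (m<n⇒m<1+n u< , Cu)
    earlier : ∀ {u v} → Tried (suc (toℕ v)) u → Tried (toℕ v) u ⊎ u ≡ v × C v ≡ true
    earlier (inj₁ Du) = inj₁ (inj₁ Du)
    earlier {u} {v} (inj₂ (u< , Cu)) with u Fin.≟ v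
    ... | yes refl = inj₂ (refl , Cu)
    ... | no  u≢v  = inj₁ (inj₂ (≤∧≢⇒< (s≤s⁻¹ u<) (u≢v ∘ toℕ-injective) , Cu))
    advance : ∀ {g} v → Greedy G (Tried (toℕ v)) g → Keeps D f g →
              let g′ = if C v then try G v g else g in
              Greedy G (Tried (suc (toℕ v))) g′ × Keeps D f g′
    advance v gr kp with C v in Cv
    ... | true =
      greedy-⇔ G (λ { (inj₁ t) → later t ; (inj₂ refl) → inj₂ (≤-refl , Cv) })
                 (λ t → [ inj₁ , (λ (eq , _) → inj₂ eq) ]′ (earlier t)) (try-greedy G gr v) ,
      λ Dv fv → try-keeps G gr v (inj₁ Dv) (kp Dv fv)
    ... | false = greedy-⇔ G later (λ t → [ id , (λ (_ , Cv′) → absurd Cv Cv′) ]′ (earlier t)) gr , kp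
      where
      absurd : ∀ {x} {A : Set} → x ≡ false → x ≡ true → A
      absurd refl ()
    body : ∀ v → Triple (λ X → X 7 ≡ toℕ v × Inv (toℕ v) X) c
                        (λ X → X 7 ≡ toℕ v × Inv (suc (toℕ v)) X)
    body v (X7 , g , s , gr , kp) with step g v (X7 , s)
    ... | Y , e , Y7 , sY = Y , e , Y7 , _ , sY , advance v gr kp
  ... | Y , e , g , sY , gr , kp = Y , e , g , sY ,
    greedy-⇔ G (λ { (inj₁ Dv) → inj₁ Dv ; (inj₂ (_ , Cv)) → inj₂ Cv })
               (λ { (inj₁ Dv) → inj₁ Dv ; (inj₂ Cv) → inj₂ (toℕ<n _ , Cv) }) gr , kp

  exec-reset : ∀ {k q a g F} → Triple (State k q a (assign true g F)) reset
                                      (State k q a (assign true (λ _ → true) F))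
  exec-reset {k} {q} {a} {g} {F} s
    with exec-loop 7 _ Inv (λ (_ , s , _) → s .one) (λ (_ , s , _) → s .size)
           (λ (g , s , r) → g , scratch 7 s , r) (λ (g , s , r) → g , scratch 15 s , r) (λ ())
           (by-vertex {λ j X → X 7 ≡ j × Inv j X} {λ j X → X 7 ≡ j × Inv (suc j) X} body) 0<n
           (g , s , λ ())
    where
    Inv : ℕ → Registers → Set
    Inv j X = ∃[ g ] State k q a (assign true g F) X × (∀ {u} → toℕ u < j → g u ≡ true)
    body : ∀ v → Triple (λ X → X 7 ≡ toℕ v × Inv (toℕ v) X) (op (add 10 5 7) ⨾ op (store 10 6))
                        (λ X → X 7 ≡ toℕ v × Inv (suc (toℕ v)) X)
    body v {X} (X7 , g , s , old) =
      _ , exec-add 10 5 7 (cong₂ _+_ (s .bases true) X7) ▸ exec-store 10 6 {X₁} refl (s .zer) ,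
      trans (update-other X₁ {x = 0} (cell-low true v (<ᵇ⇒< 7 16 _))) X7 , g′ ,
      assign-write {F = F} true v 0 (scratch 10 s) g′v (λ u≢v →
        cong (if_then true else g _) (dec-false (_ Fin.≟ v) u≢v)) ,
      new
      where
      X₁ : Registers
      X₁ = X [ 10 ↦ cell true v ]
      g′ : Fin n → Bool
      g′ u = if does (u Fin.≟ v) then true else g u
      g′v : g′ v ≡ true
      g′v = cong (if_then true else g v) (dec-true (v Fin.≟ v) refl)
      new : ∀ {u} → toℕ u < suc (toℕ v) → g′ u ≡ true
      new {u} u< with u Fin.≟ v
      ... | yes _  = refl
      ... | no u≢v = old (≤∧≢⇒< (s≤s⁻¹ u<) (u≢v ∘ toℕ-injective))
  ... | Y , e , g , sY , all = Y , e , state-≗ (assign-cong true (λ u → all (toℕ<n u))) sY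

  exec-tryTuple : ∀ {q a F f} j → j ≤ K → Greedy G (λ _ → ⊥) f →
    Triple (State 0 q a (assign true f F)) (tryTuple j)
           (λ X → ∃[ f′ ] State 0 q a (assign true f′ F) X × Greedy G (Entry G j q) f′)
  exec-tryTuple {f = f} zero j≤K gr s =
    _ , exec-skip , f , s , greedy-⇔ G (λ ()) (λ { (_ , () , _) }) gr
  exec-tryTuple {q} {F = F} (suc j) j<K gr s with exec-tryTuple {F = F} j (<⇒≤ j<K) gr s
  ... | Y , e , f , sY , grY
    with exec-try (q j) f true {F = F} {X = Y [ 7 ↦ toℕ (q j) ]} (refl , scratch 7 sY)
  ... | Z , e′ , _ , sZ = Z ,
    e ▸ exec-add 7 (16 + j) 6 (trans (cong₂ _+_ (sY .tuple z≤n j<K) (sY .zer)) (+-identityʳ _)) ▸ e′ ,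
    try G (q j) f , sZ ,
    greedy-⇔ G (λ { (inj₁ (i , i<j , eq)) → i , m<n⇒m<1+n i<j , eq ; (inj₂ refl) → j , ≤-refl , refl })
               entry (try-greedy G grY (q j))
    where
    entry : ∀ {v} → Entry G (suc j) q v → Entry G j q v ⊎ v ≡ q j
    entry (i , i<1+j , refl) with i ≟ j
    ... | yes refl = inj₂ refl
    ... | no  i≢j  = inj₁ (i , ≤∧≢⇒< (s≤s⁻¹ i<1+j) i≢j , refl)

  exec-tally : ∀ {k q a F} → Triple (State k q a F) tally
    (λ X → State k q a F X × X 13 ≡ ∣ tabulate (F false) ∣ × X 14 ≡ ∣ tabulate (F true) ∣)
  exec-tally {k} {q} {a} {F} {X} s
    with exec-loop 7 _ Inv (λ (s , _) → s .one) (λ (s , _) → s .size)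
           (λ (s , r) → scratch 7 s , r) (λ (s , r) → scratch 15 s , r) (λ ())
           (by-vertex {λ j X → X 7 ≡ j × Inv j X} {λ j X → X 7 ≡ j × Inv (suc j) X} body) 0<n
           {X [ 13 ↦ 0 ] [ 14 ↦ 0 ]}
           (scratch 14 (scratch 13 s) , sym (prefixCount-zero (F false)) , sym (prefixCount-zero (F true)))
    where
    Counts : Fin n → ℕ → ℕ → Registers → Set
    Counts v i j X = X 7 ≡ toℕ v × State k q a F X ×
                     X 13 ≡ prefixCount (F false) i × X 14 ≡ prefixCount (F true) j
    Inv : ℕ → Registers → Set
    Inv j X = State k q a F X × X 13 ≡ prefixCount (F false) j × X 14 ≡ prefixCount (F true) j
    count : ∀ {f : Fin n → Bool} {v b} → f v ≡ b →
            prefixCount f (toℕ v) + bit b ≡ prefixCount f (suc (toℕ v))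
    count {f} {v} refl = sym (prefixCount-suc f v)
    count₁ : ∀ v → Triple (Counts v (toℕ v) (toℕ v)) (whenFree false (op (add 13 13 1)))
                          (Counts v (suc (toℕ v)) (toℕ v))
    count₁ v = exec-whenFree {F = F} false _ v {Counts v (toℕ v) (toℕ v)} {Counts v (suc (toℕ v)) (toℕ v)} (λ (X7 , s , _) → s , X7)
      (λ (X7 , s , r) → X7 , scratch 10 s , r) (λ (X7 , s , r) → X7 , scratch 11 s , r)
      (λ fv {X} (X7 , s , c , d) → X [ 13 ↦ X 13 + X 1 ] , exec-add 13 13 1 refl , X7 , scratch 13 s ,
         trans (cong₂ _+_ c (s .one)) (count {F false} fv) , d)
      (λ fv (X7 , s , c , d) → X7 , s , trans c (trans (sym (+-identityʳ _)) (count {F false} fv)) , d)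
    count₂ : ∀ v → Triple (Counts v (suc (toℕ v)) (toℕ v)) (whenFree true (op (add 14 14 1)))
                          (Counts v (suc (toℕ v)) (suc (toℕ v)))
    count₂ v = exec-whenFree {F = F} true _ v {Counts v (suc (toℕ v)) (toℕ v)} {Counts v (suc (toℕ v)) (suc (toℕ v))} (λ (X7 , s , _) → s , X7)
      (λ (X7 , s , r) → X7 , scratch 10 s , r) (λ (X7 , s , r) → X7 , scratch 11 s , r)
      (λ fv {X} (X7 , s , c , d) → X [ 14 ↦ X 14 + X 1 ] , exec-add 14 14 1 refl , X7 , scratch 14 s ,
         c , trans (cong₂ _+_ d (s .one)) (count {F true} fv))
      (λ fv (X7 , s , c , d) → X7 , s , c , trans d (trans (sym (+-identityʳ _)) (count {F true} fv)))
    body : ∀ v → Triple (λ X → X 7 ≡ toℕ v × Inv (toℕ v) X)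
                        (whenFree false (op (add 13 13 1)) ⨾ whenFree true (op (add 14 14 1)))
                        (λ X → X 7 ≡ toℕ v × Inv (suc (toℕ v)) X)
    body v p with count₁ v p
    ... | Y , e , p′ with count₂ v p′
    ... | Z , e′ , p″ = Z , e ▸ e′ , p″
  ... | Y , e , sY , c , d = Y , exec-const 13 0 ▸ exec-const 14 0 ▸ e , sY ,
    trans c (prefixCount-all (F false)) , trans d (prefixCount-all (F true))

  exec-judge : ∀ {k q a F c d} → Triple (λ X → State k q a F X × X 13 ≡ c × X 14 ≡ d) judge
    (λ X → c ≡ d × State k q a F X ⊎ c ≢ d × State k q 0 F X)
  exec-judge {c = c} {d} {X} (s , refl , refl) = judged (c ≟ d)
    where
    X′ : Registers
    X′ = X [ 11 ↦ c ∸ d ] [ 12 ↦ d ∸ c ] [ 11 ↦ (c ∸ d) + (d ∸ c) ] [ 11 ↦ 1 ∸ ((c ∸ d) + (d ∸ c)) ]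
    s′ : State _ _ _ _ X′
    s′ = scratch 11 (scratch 11 (scratch 12 (scratch 11 s)))
    judged : _ → _
    judged (yes c≡d) = _ , exec-sub 11 13 14 refl ▸ exec-sub 12 14 13 refl ▸ exec-add 11 11 12 refl ▸
      exec-sub 11 1 11 (cong (_∸ ((c ∸ d) + (d ∸ c))) (s .one)) ▸ exec-ifz-no {X = X′} nonzero , inj₁ (c≡d , s′)
      where
      nonzero : 1 ∸ ((c ∸ d) + (d ∸ c)) ≢ 0
      nonzero eq with trans (sym (cong (1 ∸_) (cong₂ _+_ (m≤n⇒m∸n≡0 (≤-reflexive c≡d))
                                                        (m≤n⇒m∸n≡0 (≤-reflexive (sym c≡d)))))) eq
      ... | ()
    judged (no c≢d) = _ , exec-sub 11 13 14 refl ▸ exec-sub 12 14 13 refl ▸ exec-add 11 11 12 refl ▸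
      exec-sub 11 1 11 (cong (_∸ ((c ∸ d) + (d ∸ c))) (s .one)) ▸ exec-ifz-yes {X = X′} vanishes (exec-const 0 0) ,
      inj₂ (c≢d , record
        { answer = refl ; one = s′ .one ; size = s′ .size
        ; bases = λ { false → s′ .bases false ; true → s′ .bases true }
        ; zer = s′ .zer ; tuple = s′ .tuple
        ; free = λ b v → trans (cong (_≡ᵇ 0) (update-other X′ (≢-sym (cell-low b v (<ᵇ⇒< 0 16 _))))) (s′ .free b v) })
      where
      positive : 0 < (c ∸ d) + (d ∸ c)
      positive with <-cmp c d
      ... | tri< c<d _ _ = ≤-trans (m<n⇒0<n∸m c<d) (m≤n+m _ (c ∸ d))
      ... | tri≈ _ c≡d _ = contradiction c≡d c≢d
      ... | tri> _ _ d<c = ≤-trans (m<n⇒0<n∸m d<c) (m≤m+n _ (d ∸ c))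
      vanishes : 1 ∸ ((c ∸ d) + (d ∸ c)) ≡ 0
      vanishes = m≤n⇒m∸n≡0 positive

  -- The search through all tuples

  module _ (t : Fin n → Bool) (maxT : MaximalIndependent G (tabulate t)) where

    -- The invariant of the answer register. The alternative 0 is final: it records two maximal
    -- independent sets of different sizes, and no later test can undo that.
    Known : ((ℕ → Fin n) → Set) → ℕ → Set
    Known Done a = a ≡ 1 × (∀ q → Done q → Passes G K (tabulate t) q) ⊎ a ≡ 0 × ¬ WellCovered G

    -- The array of the current run is left unspecified; only that of `T` must survive from test to
    -- test.
    Verdict : ((ℕ → Fin n) → Set) → ℕ → (ℕ → Fin n) → Registers → Set
    Verdict Done k q X = ∃[ a ] ∃[ F ] F false ≗ t × State k q a F X × Known Done a

    verdict-map : ∀ {D D′ k k′ q q′ X X′} → (∀ {a F} → State k q a F X → State k′ q′ a F X′) →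
                  (∀ {q} → D′ q → D q) → Verdict D k q X → Verdict D′ k′ q′ X′
    verdict-map st done (a , F , F≗ , s , inj₁ (eq , all)) =
      a , F , F≗ , st s , inj₁ (eq , λ q → all q ∘ done)
    verdict-map st done (a , F , F≗ , s , inj₂ ¬wc) = a , F , F≗ , st s , inj₂ ¬wc

    Agree : ℕ → (q q′ : ℕ → Fin n) → Set
    Agree k q q′ = ∀ i → k ≤ i → i < K → q′ i ≡ q i

    -- A tuple is a sequence of which only the first `K` entries matter, so one machine run settles
    -- all sequences with these entries.
    passes-agree : ∀ {q q′} → Agree 0 q q′ → Passes G K (tabulate t) q → Passes G K (tabulate t) q′
    passes-agree eq (F , maxF , unr , card) = F , maxF , unr′ , card
      where
      unr′ : Unrestrained G K _ (tabulate t) F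
      unr′ J indJ q∈J with unr J indJ (λ i<K → subst (_∈ J) (eq _ z≤n i<K) (q∈J i<K))
      ... | q∈F , rest = (λ i<K → subst (_∈ F) (sym (eq _ z≤n i<K)) (q∈F i<K)) , rest

    exec-run : ∀ {q a F} → F false ≗ t →
      Triple (State 0 q a F)
             (greedyRun K)
             (λ X → ∃[ f ] State 0 q a (assign true f F) X × MaximalIndependent G (tabulate f) ×
                           Unrestrained G K q (tabulate t) (tabulate f))
    exec-run {q} {a} {F} F≗ s with exec-reset (state-≗ (λ b v → cong (λ f → f v) (assign-self true F b)) s)
    ... | Y₀ , e₀ , s₀
      with exec-tryTuple {F = F} K ≤-refl (record { blocks = λ () ; blocked = λ () }) s₀
    ... | Y₁ , e₁ , f₁ , s₁ , g₁
      with exec-pass true _ t {F = F} chosen g₁ s₁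
      where
      chosen : ∀ g v → Triple (λ X → X 7 ≡ toℕ v × State 0 q a (assign true g F) X)
        (whenFree false (tryCmd true))
        (λ X → X 7 ≡ toℕ v × State 0 q a (assign true (if t v then try G v g else g) F) X)
      chosen g v = exec-whenFree false _ v (λ (X7 , s) → s , X7)
        (λ (X7 , s) → X7 , scratch 10 s) (λ (X7 , s) → X7 , scratch 11 s)
        (λ fv → subst (λ b → Triple _ _ (λ X → X 7 ≡ toℕ v × State 0 q a (assign true (if b then try G v g else g) F) X))
                      (sym (trans (sym (F≗ v)) fv)) (exec-try v g true))
        (λ fv → subst (λ b → ∀ {X} → _ → X 7 ≡ toℕ v × State 0 q a (assign true (if b then try G v g else g) F) X)
                      (sym (trans (sym (F≗ v)) fv)) id)
    ... | Y₂ , e₂ , f₂ , s₂ , g₂ , k₂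
      with exec-pass true _ (λ _ → true) {F = F} (λ g v → exec-try v g true) g₂ s₂
    ... | Y₃ , e₃ , f₃ , s₃ , g₃ , k₃ =
      Y₃ , e₀ ▸ e₁ ▸ e₂ ▸ e₃ , f₃ , s₃ , greedy-maximal G g₃ (λ _ → inj₂ refl) ,
      greedy-unrestrained G t (proj₁ maxT) g₁ k₂ g₂ k₃

    Compared : ∀ q a F → Registers → Set
    Compared q a F Y = ∃[ f ]
      MaximalIndependent G (tabulate f) × Unrestrained G K q (tabulate t) (tabulate f) ×
      (∣ tabulate (F false) ∣ ≡ ∣ tabulate f ∣ × State 0 q a (assign true f F) Y ⊎
       ∣ tabulate (F false) ∣ ≢ ∣ tabulate f ∣ × State 0 q 0 (assign true f F) Y)

    exec-compared : ∀ {q a F} → F false ≗ t → Triple (State 0 q a F) (test K) (Compared q a F)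
    exec-compared {q} {a} {F} F≗ = exec-seq (exec-run F≗) λ (f , sY , maxF , unr) →
      exec-map (λ j → f , maxF , unr , j) (exec-seq exec-tally exec-judge sY)

    compared-verdict : ∀ {D q a F Y} → F false ≗ t → Known D a →
                       Compared q a F Y → Verdict (λ q′ → D q′ ⊎ Agree 0 q q′) 0 q Y
    compared-verdict {D} {q} {a} {F} {Y} F≗ known (f , maxF , unr , r) = verdict known r
      where
      ∣T∣ : ∣ tabulate (F false) ∣ ≡ ∣ tabulate t ∣
      ∣T∣ = cong ∣_∣ (tabulate-cong F≗)
      known′ : ∣ tabulate (F false) ∣ ≡ ∣ tabulate f ∣ → Known D a →
               Known (λ q′ → D q′ ⊎ Agree 0 q q′) a
      known′ eq (inj₂ ¬wc)          = inj₂ ¬wc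
      known′ eq (inj₁ (a≡1 , all)) = inj₁ (a≡1 , λ
        { q′ (inj₁ d)  → all q′ d
        ; q′ (inj₂ ag) → passes-agree ag (tabulate f , maxF , unr , trans (sym eq) ∣T∣) })
      verdict : Known D a →
        ∣ tabulate (F false) ∣ ≡ ∣ tabulate f ∣ × State 0 q a (assign true f F) Y ⊎
        ∣ tabulate (F false) ∣ ≢ ∣ tabulate f ∣ × State 0 q 0 (assign true f F) Y →
        Verdict (λ q′ → D q′ ⊎ Agree 0 q q′) 0 q Y
      verdict k (inj₁ (eq , s))  = a , assign true f F , F≗ , s , known′ eq k
      verdict k (inj₂ (neq , s)) = 0 , assign true f F , F≗ , s ,
        inj₂ (refl , λ wc → neq (trans ∣T∣ (wc _ _ maxT maxF)))

    exec-test : ∀ {D q} → Triple (Verdict D 0 q) (test K) (Verdict (λ q′ → D q′ ⊎ Agree 0 q q′) 0 q)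
    exec-test {D} {q} (a , F , F≗ , s , known) =
      exec-map (compared-verdict {D} {q} {a} {F} F≗ known) (exec-compared F≗ s)

    override : ℕ → (ℕ → Fin n) → Fin n → ℕ → Fin n
    override k q v i = if does (i ≟ k) then v else q i

    override-new : ∀ k q v → override k q v k ≡ v
    override-new k q v rewrite dec-true (k ≟ k) refl = refl

    override-old : ∀ k q v {i} → k < i → override k q v i ≡ q i
    override-old k q v {i} k<i rewrite dec-false (i ≟ k) (>⇒≢ k<i) = refl

    state-weaken : ∀ {k q v a F X} → State k (override k q v) a F X → State (suc k) q a F X
    state-weaken {k} {q} {v} s = record
      { answer = s .answer ; one = s .one ; size = s .size ; bases = s .bases ; zer = s .zer
      ; tuple = λ k< i< → trans (s .tuple (<⇒≤ k<) i<) (cong toℕ (override-old k q v k<))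
      ; free = s .free }

    state-strengthen : ∀ {k q v a F X} → X (16 + k) ≡ toℕ v → State (suc k) q a F X →
                       State k (override k q v) a F X
    state-strengthen {k} {q} {v} {X = X} eq s = record
      { answer = s .answer ; one = s .one ; size = s .size ; bases = s .bases ; zer = s .zer
      ; tuple = tuple′ ; free = s .free }
      where
      tuple′ : ∀ {i} → k ≤ i → i < K → X (16 + i) ≡ toℕ (override k q v i)
      tuple′ {i} k≤i i<K with k ≟ i
      ... | yes refl = trans eq (cong toℕ (sym (override-new k q v)))
      ... | no  k≢i  = trans (s .tuple (≤∧≢⇒< k≤i k≢i) i<K)
                             (cong toℕ (sym (override-old k q v (≤∧≢⇒< k≤i k≢i))))

    state-tuple-write : ∀ {k q a F X x} → k < K → State (suc k) q a F X →
                        State (suc k) q a F (X [ 16 + k ↦ x ])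
    state-tuple-write {k} {q} {X = X} k<K s = record
      { answer = s .answer ; one = s .one ; size = s .size
      ; bases = λ { false → s .bases false ; true → s .bases true } ; zer = s .zer
      ; tuple = λ k< i< → trans (update-other X (>⇒≢ (+-monoʳ-< 16 k<))) (s .tuple k< i<)
      ; free = λ b v → trans (cong (_≡ᵇ 0) (update-other X (≢-sym (cell-high b v (+-monoʳ-< 16 k<K)))))
                             (s .free b v) }

    verdict-state : ∀ {D k q X} {A : Set} → (∀ {a F} → State k q a F X → A) → Verdict D k q X → A
    verdict-state f (_ , _ , _ , s , _) = f s

    -- Level `k` settles all sequences that agree with `q` from index `k` on. The claim is made for
    -- arbitrary `D`, because the inner loops start with what earlier values of the entry `k` have
    -- already settled.
    exec-forTuples : ∀ {c} →
      (∀ {D q} → Triple (Verdict D 0 q) c (Verdict (λ q′ → D q′ ⊎ Agree 0 q q′) 0 q)) →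
      ∀ k → k ≤ K → ∀ {D q} →
      Triple (Verdict D k q) (forTuples k c) (Verdict (λ q′ → D q′ ⊎ Agree k q q′) k q)
    exec-forTuples spec zero    k≤K = spec
    exec-forTuples {c} spec (suc k) k<K {D} {q} verdict
      with exec-loop (16 + k) (forTuples k c) Inv
             (verdict-state one) (verdict-state size)
             (verdict-map (state-tuple-write k<K) id) (verdict-map (scratch 15) id) (λ ())
             (by-vertex {λ j X → X (16 + k) ≡ j × Inv j X} {λ j X → X (16 + k) ≡ j × Inv (suc j) X} body)
             0<n
             -- No entry is below 0, so before the first round nothing beyond `D` is claimed.
             (verdict-map id (λ { (inj₁ Dq) → Dq ; (inj₂ ()) }) verdict)
      where
      Done : ℕ → (ℕ → Fin n) → Set
      Done j q′ = D q′ ⊎ toℕ (q′ k) < j × Agree (suc k) q q′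
      Inv : ℕ → Registers → Set
      Inv j = Verdict (Done j) (suc k) q
      body : ∀ v → Triple (λ X → X (16 + k) ≡ toℕ v × Inv (toℕ v) X) (forTuples k c)
                          (λ X → X (16 + k) ≡ toℕ v × Inv (suc (toℕ v)) X)
      body v (eq , vd)
        with exec-forTuples spec k (<⇒≤ k<K) (verdict-map (state-strengthen {v = v} eq) id vd)
      ... | Y , e , vd′ = Y , e ,
        trans (verdict-state (λ s → s .tuple ≤-refl k<K) vd′) (cong toℕ (override-new k q v)) ,
        verdict-map state-weaken done vd′
        where
        agree : ∀ {q′} → q′ k ≡ v → Agree (suc k) q q′ → Agree k (override k q v) q′
        agree q′k ag i k≤i i<K with k ≟ i
        ... | yes refl = trans q′k (sym (override-new k q v))
        ... | no  k≢i  = trans (ag i (≤∧≢⇒< k≤i k≢i) i<K) (sym (override-old k q v (≤∧≢⇒< k≤i k≢i)))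
        done : ∀ {q′} → Done (suc (toℕ v)) q′ → Done (toℕ v) q′ ⊎ Agree k (override k q v) q′
        done (inj₁ Dq′) = inj₁ (inj₁ Dq′)
        done {q′} (inj₂ (q′k< , ag)) with q′ k Fin.≟ v
        ... | yes q′k≡v = inj₂ (agree q′k≡v ag)
        ... | no  q′k≢v = inj₁ (inj₂ (≤∧≢⇒< (s≤s⁻¹ q′k<) (q′k≢v ∘ toℕ-injective) , ag))
    ... | Y , e , vd = Y , e , verdict-map id [ inj₁ , (λ ag → inj₂ (toℕ<n _ , ag)) ]′ vd

  -- The constant sequence is a placeholder: at level `K` no entry is fixed yet, so agreement with
  -- it is vacuous and the search settles every tuple.
  exec-main : ∀ {X} → State K (λ _ → fromℕ< 0<n) 1 (λ _ _ → true) X →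
    ∃[ Y ] Exec (loop 7 (tryCmd false) ⨾ forTuples K (test K)) X Y ×
           (Y 0 ≡ 1 × (∃[ T ] MaximalIndependent G T × (∀ q → Passes G K T q)) ⊎
            Y 0 ≡ 0 × ¬ WellCovered G)
  exec-main s
    with exec-pass false _ (λ _ → true) {F = λ _ _ → true} (λ g v → exec-try v g false)
           {D = λ _ → ⊥} (record { blocks = λ () ; blocked = λ () })
           (state-≗ (λ { false _ → refl ; true _ → refl }) s)
  ... | Y , e , t , sY , g , _
    with exec-forTuples t (greedy-maximal G g (λ _ → inj₂ refl))
                          (exec-test t (greedy-maximal G g (λ _ → inj₂ refl)))
           K ≤-refl {D = λ _ → ⊥}
           (1 , assign false t (λ _ _ → true) , (λ _ → refl) , sY , inj₁ (refl , λ _ ()))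
  ... | Z , e′ , _ , F , _ , sZ , inj₁ (a≡1 , all) = Z , e ▸ e′ ,
    inj₁ (trans (sZ .answer) a≡1 , tabulate t , greedy-maximal G g (λ _ → inj₂ refl) ,
          λ q → all q (inj₂ λ _ K≤i i<K → contradiction i<K (≤⇒≯ K≤i)))
  ... | Z , e′ , _ , F , _ , sZ , inj₂ (a≡0 , ¬wc) = Z , e ▸ e′ , inj₂ (trans (sZ .answer) a≡0 , ¬wc)

-- From verified commands to polynomial-time decision

n≤length-encode : ∀ {n} (G : Graph n) → n ≤ length (encode G)
n≤length-encode {n} G = ≤-trans (n≤1+n² n) (≤-reflexive (cong suc (sym (length-tabulate _))))
  where
  n≤1+n² : ∀ n → n ≤ suc (n * n)
  n≤1+n² zero    = z≤n
  n≤1+n² (suc n) = m≤n⇒m≤1+n (m≤m*n (suc n) (suc n))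

Answers : ∀ {n} → GraphProperty → Graph n → Registers → Set
Answers P G Y = Y 0 ≡ 1 × P G ⊎ Y 0 ≡ 0 × ¬ P G

polyTimeDecidable : ∀ {Promise P : GraphProperty} (c : Cmd) →
  (∀ {n} (G : Graph n) → Promise G →
     ∃[ Y ] Semantics.Exec n (encode G) c (λ _ → 0) Y × Answers P G Y) →
  PolyTimeDecidable Promise P
polyTimeDecidable {P = P} c spec =
  p , coefficient c , degree c , λ G promise → decides G (spec G promise)
  where
  p : Program
  p = compile 0 c
  halts : fetch p (end c 0) ≡ halt
  halts = trans (cong (fetch p) (trans (sym (end-compile c 0)) (+-identityʳ _))) (fetch-length p)
  decides : ∀ {n} (G : Graph n) →
    ∃[ Y ] Semantics.Exec n (encode G) c (λ _ → 0) Y × Answers P G Y →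
    ∃[ t ] t ≤ coefficient c * length (encode G) ^ degree c + coefficient c ×
           (HaltsWith p (encode G) t 1 × P G ⊎ HaltsWith p (encode G) t 0 × ¬ P G)
  decides {n} G (Y , e , answers) with Semantics.reaches e p 0 (codeAt-self p)
  ... | t , t≤ , ran =
    t , ≤-trans t≤ (≤-trans (cost-polynomial (n≤length-encode G) (s≤s z≤n) c) (m≤m+n _ _)) ,
    Sum.map (Product.map₁ halted) (Product.map₁ halted) answers
    where
    halted : ∀ {x} → Y 0 ≡ x → HaltsWith p (encode G) t x
    halted Y0 rewrite ran = halts , Y0

module _ {n} (G : Graph n) (K : ℕ) where
  open Semantics n (encode G)

  private
    search : Cmd
    search = loop 7 (tryCmd false) ⨾ forTuples K (test K)

    start : Registers
    start = (λ _ → 0) [ 1 ↦ 1 ] [ 2 ↦ n ] [ 4 ↦ 16 + K ] [ 5 ↦ 16 + K + n ] [ 0 ↦ 1 ] [ 11 ↦ 1 ∸ n ]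

    exec-setup : ∀ {Y} → Exec (ifz 11 search) start Y → Exec (main K) (λ _ → 0) Y
    exec-setup e = exec-const 1 1 ▸ exec-read 2 6 refl refl ▸ exec-const 4 (16 + K) ▸
                   exec-add 5 4 2 refl ▸ exec-const 0 1 ▸ exec-sub 11 1 2 refl ▸ e

  -- The structure of `G` enters through the hypothesis alone; an answer 0 is justified in every
  -- graph.
  exec-decides : (∀ {T} → MaximalIndependent G T → (∀ q → Passes G K T q) → WellCovered G) →
                 ∃[ Y ] Exec (main K) (λ _ → 0) Y × Answers WellCovered G Y
  exec-decides wellCovered with 0 <? n
  ... | no  0≮n = start , exec-setup (exec-ifz-no {X = start} 1∸n≢0) , inj₁ (refl , empty)
    where
    1∸n≢0 : 1 ∸ n ≢ 0
    1∸n≢0 eq with trans (sym eq) (cong (1 ∸_) (n≤0⇒n≡0 (≮⇒≥ 0≮n)))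
    ... | ()
    ∣I∣≡0 : ∀ I → ∣ I ∣ ≡ 0
    ∣I∣≡0 I = n≤0⇒n≡0 (≤-trans (∣p∣≤n I) (≮⇒≥ 0≮n))
    empty : WellCovered G
    empty I J _ _ = trans (∣I∣≡0 I) (sym (∣I∣≡0 J))
  ... | yes 0<n = finish (exec-main initially)
    where
    open Spec G 0<n K
    initially : State K (λ _ → fromℕ< 0<n) 1 (λ _ _ → true) start
    initially = record
      { answer = refl ; one = refl ; size = refl ; zer = refl
      ; bases = λ { false → refl ; true → refl }
      ; tuple = λ K≤i i<K → contradiction i<K (≤⇒≯ K≤i)
      ; free = λ { false v → refl ; true v → refl } }
    finish : ∃[ Y ] Exec search start Y ×
               (Y 0 ≡ 1 × (∃[ T ] MaximalIndependent G T × (∀ q → Passes G K T q)) ⊎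
                Y 0 ≡ 0 × ¬ WellCovered G) →
             ∃[ Y ] Exec (main K) (λ _ → 0) Y × Answers WellCovered G Y
    finish (Y , e , r) = Y , exec-setup (exec-ifz-yes {X = start} (m≤n⇒m∸n≡0 0<n) e) ,
      map₁ (λ (Y0 , _ , maxT , passes) → Y0 , wellCovered maxT passes) r

corollary5 : (ℓ : ℕ) → PolyTimeDecidable (Partition 1 ℓ) WellCovered
corollary5 ℓ = polyTimeDecidable (main (suc (ℓ + ℓ)))
  -- The partition is available to the correctness proof, while the program depends on `ℓ` only.
  λ G P → exec-decides G (suc (ℓ + ℓ)) (passes⇒wellCovered G P)
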